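{- For $n\ge 1$ and integers $i,j$, let $\overline{b}_{n,i,j}$ be the number of $\pi\in\mathfrak{B}_n$ with $\operatorname{des}^B(\pi)=i$ and $\operatorname{ides}^B(\pi)=j$ (so $\overline{b}_{n,i,j}=0$ if $i<0$ or $j<0$). Then $\overline{b}_{1,0,0}=\overline{b}_{1,1,1}=1$, $\overline{b}_{1,0,1}=\overline{b}_{1,1,0}=0$, and for all $n\ge 2$ and $0\le i,j\le n$, \[ \begin{aligned} n\,\overline{b}_{n,i,j}={}&(n+i+j+2ij)\,\overline{b}_{n-1,i,j}+\big((2n-1)i-(2i+1)(j-1)\big)\,\overline{b}_{n-1,i,j-1}\\ &+\big((2n-1)j-(2j+1)(i-1)\big)\,\overline{b}_{n-1,i-1,j}\\ &+\big((2n^2-n)+2(i-1)(j-1)+(1-2n)(i+j-2)\big)\,\overline{b}_{n-1,i-1,j-1}. \end{aligned} \]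
   Context: For a positive integer $n$, $\mathfrak{B}_n$ is the set of signed permutations of length $n$: words $\pi=\pi_1\cdots\pi_n$ with $\pi_i\in\{\pm1,\dots,\pm n\}$ such that $|\pi_1|,\dots,|\pi_n|$ is a permutation of $[n]=\{1,\dots,n\}$. Set $\pi_0=0$. The inverse $\pi^{ -1}\in\mathfrak{B}_n$ is defined by $\pi^{ -1}_{|\pi_i|}=\operatorname{sgn}(\pi_i)\,i$. With the natural order $\cdots<-2<-1<0<1<2<\cdots$ on $\mathbb{Z}$, define $\operatorname{des}^B(\pi)=|\{i\in\{0,1,\dots,n-1\}:\pi_i>\pi_{i+1}\}|$ and $\operatorname{ides}^B(\pi)=\operatorname{des}^B(\pi^{ -1})$. -}

module Defs where

open import Data.Nat as ℕ using (ℕ; zero; suc)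
open import Data.Integer as ℤ using (ℤ; +_; -[1+_]; ∣_∣; _<?_; _≟_)
open import Data.List using (List; []; _∷_; map; concatMap; filter; length; upTo; applyUpTo)
open import Data.List.Relation.Unary.Unique.Propositional using (Unique)
open import Data.List.Relation.Unary.All using (All)
open import Data.List.Relation.Unary.All as All using (all?)
open import Data.List.Relation.Unary.Unique.Propositional.Properties using ()
open import Relation.Nullary using (Dec; yes; no; ¬_)
open import Relation.Nullary.Decidable using (_×-dec_)
open import Data.Product using (_×_)
import Data.Nat.Properties as ℕP
import Data.Integer.Properties as ℤP
open import Data.List.Relation.Unary.AllPairs using (allPairs?)

letters : ℕ → List ℤ
letters n = applyUpTo (λ k → + suc k) n Data.List.++ applyUpTo (λ k → -[1+ k ]) n

words : ℕ → ℕ → List (List ℤ)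
words n zero = [] ∷ []
words n (suc m) = concatMap (λ a → map (a ∷_) (words n m)) (letters n)

-- A word is a signed permutation when |π_1|,…,|π_n| are pairwise distinct
-- (all letters already lie in {±1,…,±n} and the word has length n).
distinctAbs? : (w : List ℤ) → Dec (Unique (map ∣_∣ w))
distinctAbs? w = allPairs? (λ x y → Relation.Nullary.Decidable.¬? (x ℕP.≟ y)) (map ∣_∣ w)

-- 𝔅_n, as an explicit list of signed permutations (each appearing once).
signedPerms : ℕ → List (List ℤ)
signedPerms n = filter distinctAbs? (words n n)

-- des^B: descents at positions 0..n-1 with π_0 = 0.
desFrom : ℤ → List ℤ → ℕ
desFrom prev [] = zero
desFrom prev (x ∷ xs) with x <? prev
... | yes _ = suc (desFrom x xs)
... | no _  = desFrom x xs

desB : List ℤ → ℕ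
desB = desFrom (+ 0)

-- sign of an integer (as ±1; letters are never 0)
sgnMul : ℤ → ℕ → ℤ
sgnMul (+ _) i = + i
sgnMul -[1+ _ ] i = ℤ.- (+ i)

-- value of the inverse at k: sgn(π_i)·i where |π_i| = k (positions from 1)
invAt : ℕ → ℕ → List ℤ → ℤ
invAt k i [] = + 0
invAt k i (x ∷ xs) with ∣ x ∣ ℕP.≟ k
... | yes _ = sgnMul x i
... | no _  = invAt k (suc i) xs

-- π⁻¹ = π⁻¹_1 ⋯ π⁻¹_n with π⁻¹_{|π_i|} = sgn(π_i) i
inverseB : List ℤ → List ℤ
inverseB π = applyUpTo (λ k → invAt (suc k) 1 π) (length π)

idesB : List ℤ → ℕ
idesB π = desB (inverseB π)

bNat : ℕ → ℕ → ℕ → ℕ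
bNat n i j = length (filter (λ π → (desB π ℕP.≟ i) ×-dec (idesB π ℕP.≟ j)) (signedPerms n))

b̄ : ℕ → ℤ → ℤ → ℤ
b̄ n (+ i) (+ j) = + bNat n i j
b̄ n _ _ = + 0

{-# OPTIONS --safe #-}
-- Deleting the p-th letter x of a signed permutation of length n, and closing the gap left by |x|, is for
-- every p a bijection onto pairs of a letter and a signed permutation w of length n − 1; so n b_n is a sum
-- over all insertions of x = ±v at position p of w. An insertion keeps des^B or raises it by 1, and the
-- indicator of keeping it is [w_p < w_{p-1}] + F(p-1,v) − F(p,v) with F(p,v) = [w_p < x after renumbering].
-- Inserting x = ±v at p in w inserts ±p at v in w⁻¹, so ides^B has the same kind of indicator, with v and p
-- exchanged. The four coefficients are sums over p, v and the sign of products of these indicators. The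
-- sums linear in F telescope; in the bilinear one, w_p = ±v ⇔ w⁻¹_v = ±p turns the product of
-- differences into a mixed second difference plus the indicator of w_p = ±v, and these indicators sum to n.
-- Hence the coefficients depend on w only through des^B(w) and ides^B(w).
module Submission where

open import Defs
open import Data.Nat using (ℕ; _≤_; zero; suc; s≤s; z≤n)
import Data.Nat as ℕ
import Data.Nat.Properties as ℕ
open import Data.Integer using (ℤ; +_; _+_; _*_; _-_; -[1+_]; ∣_∣; -_; _<?_; _≟_; +<+; -<+; -<-)
import Data.Integer as ℤ
import Data.Integer.Properties as ℤ
open import Data.Integer.Tactic.RingSolver using (solve-∀)
open import Data.List using (List; []; _∷_; _++_; map; concatMap; length; filter; upTo; applyUpTo;
         cartesianProductWith)
open import Data.List.Properties using (map-upTo; map-∘; map-cong; map-injective; length-upTo; length-map;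
         length-applyUpTo; ∷-injective; ∷-injectiveʳ)
open import Data.List.Membership.Propositional using (_∈_)
open import Data.List.Membership.Propositional.Properties
  using (∈-upTo⁻; ∈-applyUpTo⁺; ∈-applyUpTo⁻; ∈-++⁺ˡ; ∈-++⁺ʳ; ∈-++⁻; ∈-filter⁺; ∈-filter⁻; ∈-cartesianProductWith⁺; ∈-cartesianProductWith⁻)
open import Data.List.Membership.Propositional.Properties.WithK using (unique∧set⇒bag)
open import Data.List.Relation.Binary.BagAndSetEquality using (∼bag⇒↭)
open import Data.List.Relation.Unary.Any using (here; there)
open import Data.List.Relation.Unary.All as All using (All; []; _∷_)
import Data.List.Relation.Unary.All.Properties as All
open import Data.List.Relation.Unary.AllPairs using ([]; _∷_)
open import Data.List.Relation.Unary.Unique.Propositional using (Unique)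
import Data.List.Relation.Unary.Unique.Propositional.Properties as Unique
open import Data.List.Relation.Binary.Permutation.Propositional using (_↭_; refl; prep; swap; trans; ↭-sym; ↭⇒↭ₛ)
open import Data.List.Relation.Binary.Permutation.Propositional.Properties using (All-resp-↭; ↭-length; map⁺)
import Data.List.Relation.Binary.Permutation.Setoid.Properties as Permutationₛ
open import Data.Product using (_×_; _,_; ∃; ∃₂; proj₁; proj₂)
open import Data.Sum using (_⊎_; inj₁; inj₂)
open import Function using (_∘_; mk⇔)
open import Level using (Level)
open import Relation.Nullary using (Dec; yes; no; ¬_; contradiction)
open import Relation.Nullary.Decidable using (_×-dec_)
open import Relation.Binary.PropositionalEquality
  using (_≡_; _≢_; refl; sym; cong; cong₂; subst; setoid; module ≡-Reasoning)
import Relation.Binary.PropositionalEquality as ≡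
open import Relation.Binary.Definitions using (tri<; tri≈; tri>)

open ≡-Reasoning

private variable
  ℓ ℓ′ : Level
  A : Set ℓ
  B : Set ℓ′
  X Y : Set ℓ

-- Sums over lists

∑ : List A → (A → ℤ) → ℤ
∑ []       f = + 0
∑ (x ∷ xs) f = f x + ∑ xs f

syntax ∑ xs (λ x → e) = ∑[ x ← xs ] e
infix 5 ∑

∑-cong : (xs : List A) {f g : A → ℤ} → (∀ {x} → x ∈ xs → f x ≡ g x) → ∑ xs f ≡ ∑ xs g
∑-cong []       eq = refl
∑-cong (x ∷ xs) eq = cong₂ _+_ (eq (here refl)) (∑-cong xs (eq ∘ there))

∑-ext : (xs : List A) {f g : A → ℤ} → (∀ x → f x ≡ g x) → ∑ xs f ≡ ∑ xs g
∑-ext xs eq = ∑-cong xs (λ {x} _ → eq x)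

∑-0 : (xs : List A) → ∑[ x ← xs ] (+ 0) ≡ + 0
∑-0 []       = refl
∑-0 (x ∷ xs) = ≡.trans (ℤ.+-identityˡ _) (∑-0 xs)

∑-+ : (xs : List A) (f g : A → ℤ) → ∑[ x ← xs ] (f x + g x) ≡ ∑ xs f + ∑ xs g
∑-+ []       f g = refl
∑-+ (x ∷ xs) f g = ≡.trans (cong (_+_ (f x + g x)) (∑-+ xs f g)) (interchange (f x) (g x) _ _)
  where
  interchange : ∀ a b c d → (a + b) + (c + d) ≡ (a + c) + (b + d)
  interchange = solve-∀

∑-*ˡ : (xs : List A) (c : ℤ) (f : A → ℤ) → ∑[ x ← xs ] (c * f x) ≡ c * ∑ xs f
∑-*ˡ []       c f = sym (ℤ.*-zeroʳ c)
∑-*ˡ (x ∷ xs) c f = ≡.trans (cong (_+_ (c * f x)) (∑-*ˡ xs c f)) (sym (ℤ.*-distribˡ-+ c (f x) _))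

∑-const : (xs : List A) (c : ℤ) → ∑[ x ← xs ] c ≡ + length xs * c
∑-const []       c = refl
∑-const (x ∷ xs) c = ≡.trans (cong (_+_ c) (∑-const xs c)) (sym (ℤ.suc-* (+ length xs) c))

∑-minus : (xs : List A) (f g : A → ℤ) → ∑[ x ← xs ] (f x - g x) ≡ ∑ xs f - ∑ xs g
∑-minus []       f g = refl
∑-minus (x ∷ xs) f g = ≡.trans (cong (_+_ (f x - g x)) (∑-minus xs f g)) (interchange (f x) (g x) _ _)
  where
  interchange : ∀ a b c d → (a - b) + (c - d) ≡ (a + c) - (b + d)
  interchange = solve-∀

∑-swap : (xs : List A) (ys : List B) (f : A → B → ℤ) →
         ∑[ x ← xs ] ∑[ y ← ys ] f x y ≡ ∑[ y ← ys ] ∑[ x ← xs ] f x y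
∑-swap []       ys f = sym (∑-0 ys)
∑-swap (x ∷ xs) ys f = ≡.trans (cong (_+_ (∑ ys (f x))) (∑-swap xs ys f)) (sym (∑-+ ys (f x) _))

∑₂-ext : (xs : List A) (ys : List B) {f g : A → B → ℤ} → (∀ x y → f x y ≡ g x y) →
  ∑[ x ← xs ] ∑[ y ← ys ] f x y ≡ ∑[ x ← xs ] ∑[ y ← ys ] g x y
∑₂-ext xs ys eq = ∑-ext xs (λ x → ∑-ext ys (eq x))

∑₂-+ : (xs : List A) (ys : List B) (f g : A → B → ℤ) →
  ∑[ x ← xs ] ∑[ y ← ys ] (f x y + g x y) ≡ (∑[ x ← xs ] ∑[ y ← ys ] f x y) + (∑[ x ← xs ] ∑[ y ← ys ] g x y)
∑₂-+ xs ys f g = ≡.trans (∑-ext xs (λ x → ∑-+ ys (f x) (g x))) (∑-+ xs (λ x → ∑ ys (f x)) (λ x → ∑ ys (g x)))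

∑₂-*ˡ : (xs : List A) (ys : List B) (c : ℤ) (f : A → B → ℤ) →
  ∑[ x ← xs ] ∑[ y ← ys ] (c * f x y) ≡ c * (∑[ x ← xs ] ∑[ y ← ys ] f x y)
∑₂-*ˡ xs ys c f = ≡.trans (∑-ext xs (λ x → ∑-*ˡ ys c (f x))) (∑-*ˡ xs c (λ x → ∑ ys (f x)))

∑-++ : (xs ys : List A) (f : A → ℤ) → ∑ (xs ++ ys) f ≡ ∑ xs f + ∑ ys f
∑-++ []       ys f = sym (ℤ.+-identityˡ _)
∑-++ (x ∷ xs) ys f = ≡.trans (cong (_+_ (f x)) (∑-++ xs ys f)) (sym (ℤ.+-assoc (f x) _ _))

∑-map : (xs : List A) (h : A → B) (f : B → ℤ) → ∑ (map h xs) f ≡ ∑[ x ← xs ] f (h x)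
∑-map []       h f = refl
∑-map (x ∷ xs) h f = cong (_+_ (f (h x))) (∑-map xs h f)

∑-applyUpTo : ∀ n (h : ℕ → A) (f : A → ℤ) → ∑ (applyUpTo h n) f ≡ ∑[ k ← upTo n ] f (h k)
∑-applyUpTo n h f = ≡.trans (cong (λ xs → ∑ xs f) (sym (map-upTo h n))) (∑-map (upTo n) h f)

∑-cartesianProductWith : ∀ {C : Set} (h : A → B → C) (xs : List A) (ys : List B) (f : C → ℤ) →
  ∑ (cartesianProductWith h xs ys) f ≡ ∑[ x ← xs ] ∑[ y ← ys ] f (h x y)
∑-cartesianProductWith h []       ys f = refl
∑-cartesianProductWith h (x ∷ xs) ys f = begin
  ∑ (map (h x) ys ++ cartesianProductWith h xs ys) f
    ≡⟨ ∑-++ (map (h x) ys) _ f ⟩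
  ∑ (map (h x) ys) f + ∑ (cartesianProductWith h xs ys) f
    ≡⟨ cong₂ _+_ (∑-map ys (h x) f) (∑-cartesianProductWith h xs ys f) ⟩
  (∑[ y ← ys ] f (h x y)) + (∑[ x ← xs ] ∑[ y ← ys ] f (h x y)) ∎

∑-↭ : {xs ys : List A} (f : A → ℤ) → xs ↭ ys → ∑ xs f ≡ ∑ ys f
∑-↭ f refl         = refl
∑-↭ f (prep x p)   = cong (_+_ (f x)) (∑-↭ f p)
∑-↭ f (swap x y p) = ≡.trans (cong (λ s → f x + (f y + s)) (∑-↭ f p)) (exchange (f x) (f y) _)
  where
  exchange : ∀ a b c → a + (b + c) ≡ b + (a + c)
  exchange = solve-∀
∑-↭ f (trans p q)  = ≡.trans (∑-↭ f p) (∑-↭ f q)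

∑-upTo-suc : ∀ n (f : ℕ → ℤ) → ∑ (upTo (suc n)) f ≡ f 0 + (∑[ k ← upTo n ] f (suc k))
∑-upTo-suc n f = cong (_+_ (f 0)) (∑-applyUpTo n suc f)

∑-telescope : ∀ n (f : ℕ → ℤ) → ∑[ k ← upTo n ] (f k - f (suc k)) ≡ f 0 - f n
∑-telescope zero    f = sym (ℤ.+-inverseʳ (f 0))
∑-telescope (suc n) f = begin
  ∑[ k ← upTo (suc n) ] (f k - f (suc k))
    ≡⟨ ∑-upTo-suc n (λ k → f k - f (suc k)) ⟩
  (f 0 - f 1) + (∑[ k ← upTo n ] (f (suc k) - f (suc (suc k))))
    ≡⟨ cong (_+_ (f 0 - f 1)) (∑-telescope n (f ∘ suc)) ⟩
  (f 0 - f 1) + (f 1 - f (suc n))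
    ≡⟨ cancel (f 0) (f 1) (f (suc n)) ⟩
  f 0 - f (suc n) ∎
  where
  cancel : ∀ a b c → (a - b) + (b - c) ≡ a - c
  cancel = solve-∀

-- Telescopes in `v` for each fixed `p` and then in `p`, so only the four corner values remain.
∑-telescope₂ : ∀ n (h : ℕ → ℕ → ℤ) →
  ∑[ p ← upTo n ] ∑[ v ← upTo n ] (h p v - h p (suc v) - h (suc p) v + h (suc p) (suc v))
    ≡ h 0 0 - h 0 n - (h n 0 - h n n)
∑-telescope₂ n h = begin
  ∑[ p ← upTo n ] ∑[ v ← upTo n ] (h p v - h p (suc v) - h (suc p) v + h (suc p) (suc v))
    ≡⟨ ∑-ext (upTo n) (λ p → ≡.trans (∑-ext (upTo n) (λ v → regroup (h p v) _ _ _))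
                                     (∑-telescope n (λ v → h p v - h (suc p) v))) ⟩
  ∑[ p ← upTo n ] (h p 0 - h (suc p) 0 - (h p n - h (suc p) n))
    ≡⟨ ∑-ext (upTo n) (λ p → regroup′ (h p 0) _ _ _) ⟩
  ∑[ p ← upTo n ] (h p 0 - h p n - (h (suc p) 0 - h (suc p) n))
    ≡⟨ ∑-telescope n (λ p → h p 0 - h p n) ⟩
  h 0 0 - h 0 n - (h n 0 - h n n) ∎
  where
  regroup : ∀ a b c d → a - b - c + d ≡ a - c - (b - d)
  regroup = solve-∀
  regroup′ : ∀ a b c d → a - b - (c - d) ≡ a - c - (b - d)
  regroup′ = solve-∀

-- Indicators

⟦_⟧ : Dec X → ℤ
⟦ yes _ ⟧ = + 1
⟦ no  _ ⟧ = + 0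

⟦⟧-cong : (X → Y) → (Y → X) → (p? : Dec X) (q? : Dec Y) → ⟦ p? ⟧ ≡ ⟦ q? ⟧
⟦⟧-cong f g (yes p) (yes q) = refl
⟦⟧-cong f g (yes p) (no ¬q) = contradiction (f p) ¬q
⟦⟧-cong f g (no ¬p) (yes q) = contradiction (g q) ¬p
⟦⟧-cong f g (no ¬p) (no ¬q) = refl

⟦⟧-true : X → (p? : Dec X) → ⟦ p? ⟧ ≡ + 1
⟦⟧-true p (yes _) = refl
⟦⟧-true p (no ¬p) = contradiction p ¬p

⟦⟧-false : ¬ X → (p? : Dec X) → ⟦ p? ⟧ ≡ + 0
⟦⟧-false ¬p (yes p) = contradiction p ¬p
⟦⟧-false ¬p (no _)  = refl

-- Under an indicator, two values that agree whenever it is 1 are interchangeable; later this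
-- replaces the descent numbers of a word by `i` and `j`.
⟦⟧-subst : (p? : Dec X) {x y : ℤ} → (X → x ≡ y) → ⟦ p? ⟧ * x ≡ ⟦ p? ⟧ * y
⟦⟧-subst (yes p) eq = cong (+ 1 *_) (eq p)
⟦⟧-subst (no _)  eq = refl

lt eq : ℤ → ℤ → ℤ
lt x y = ⟦ x <? y ⟧
eq x y = ⟦ x ≟ y ⟧

lt-cong : ∀ {x y z w} → (x ℤ.< y → z ℤ.< w) → (z ℤ.< w → x ℤ.< y) → lt x y ≡ lt z w
lt-cong f g = ⟦⟧-cong f g _ _

eq-cong : ∀ {x y z w} → (x ≡ y → z ≡ w) → (z ≡ w → x ≡ y) → eq x y ≡ eq z w
eq-cong f g = ⟦⟧-cong f g _ _

<-suc⁻ : ∀ {x y} → x ℤ.< ℤ.suc y → x ≢ y → x ℤ.< y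
<-suc⁻ {x} {y} x<1+y x≢y with ℤ.<-cmp x y
... | tri< x<y _ _ = x<y
... | tri≈ _ x≡y _ = contradiction x≡y x≢y
... | tri> _ _ y<x = contradiction (ℤ.<-≤-trans x<1+y (ℤ.i<j⇒suc[i]≤j y<x)) (ℤ.<-irrefl refl)

<-suc : ∀ {x y} → x ℤ.≤ y → x ℤ.< ℤ.suc y
<-suc {x} {y} x≤y = ℤ.≤-<-trans x≤y (ℤ.suc[i]≤j⇒i<j ℤ.≤-refl)

lt-suc : ∀ x y → lt x (ℤ.suc y) ≡ lt x y + eq x y
lt-suc x y with ℤ.<-cmp x y
... | tri< x<y x≢y _ = begin
  lt x (ℤ.suc y)    ≡⟨ ⟦⟧-true (<-suc (ℤ.<⇒≤ x<y)) (x <? ℤ.suc y) ⟩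
  + 1               ≡⟨ cong₂ _+_ (⟦⟧-true x<y (x <? y)) (⟦⟧-false x≢y (x ≟ y)) ⟨
  lt x y + eq x y ∎
... | tri≈ x≮y x≡y _ = begin
  lt x (ℤ.suc y)    ≡⟨ ⟦⟧-true (<-suc (ℤ.≤-reflexive x≡y)) (x <? ℤ.suc y) ⟩
  + 1               ≡⟨ cong₂ _+_ (⟦⟧-false x≮y (x <? y)) (⟦⟧-true x≡y (x ≟ y)) ⟨
  lt x y + eq x y ∎
... | tri> x≮y x≢y _ = begin
  lt x (ℤ.suc y)    ≡⟨ ⟦⟧-false (λ x<1+y → x≮y (<-suc⁻ x<1+y x≢y)) (x <? ℤ.suc y) ⟩
  + 0               ≡⟨ cong₂ _+_ (⟦⟧-false x≮y (x <? y)) (⟦⟧-false x≢y (x ≟ y)) ⟨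
  lt x y + eq x y ∎

lt*eq : ∀ x y → lt x y * eq x y ≡ + 0
lt*eq x y with x <? y | x ≟ y
... | yes x<y | yes x≡y = contradiction x<y (ℤ.<-irrefl x≡y)
... | yes x<y | no _    = refl
... | no _    | yes _   = refl
... | no _    | no _    = refl

eq*eq : ∀ x y → eq x y * eq x y ≡ eq x y
eq*eq x y with x ≟ y
... | yes _ = refl
... | no _  = refl

-- When `x ≡ y` and `z ≡ w` are equivalent, raising either bound by one adds the same indicator
-- `eq x y`. Strict inequality excludes equality, so its products with `lt x y` and `lt z w` vanish,
-- and only when both bounds rise does its square survive. This is the source of the part of the
-- bilinear sum that does not telescope.
module _ {x y z w : ℤ} (x≡y⇒z≡w : x ≡ y → z ≡ w) (z≡w⇒x≡y : z ≡ w → x ≡ y) where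

  private
    same : eq z w ≡ eq x y
    same = eq-cong z≡w⇒x≡y x≡y⇒z≡w

    vanish : lt z w * eq x y ≡ + 0
    vanish = ≡.trans (cong (lt z w *_) (sym same)) (lt*eq z w)

  lt-sucˡ : lt x (ℤ.suc y) * lt z w ≡ lt x y * lt z w
  lt-sucˡ = begin
    lt x (ℤ.suc y) * lt z w               ≡⟨ cong (_* lt z w) (lt-suc x y) ⟩
    (lt x y + eq x y) * lt z w            ≡⟨ expand (lt x y) (eq x y) (lt z w) ⟩
    lt x y * lt z w + lt z w * eq x y     ≡⟨ cong (_+_ (lt x y * lt z w)) vanish ⟩
    lt x y * lt z w + + 0                 ≡⟨ ℤ.+-identityʳ _ ⟩
    lt x y * lt z w ∎
    where
    expand : ∀ a b c → (a + b) * c ≡ a * c + c * b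
    expand = solve-∀

  lt-sucʳ : lt x y * lt z (ℤ.suc w) ≡ lt x y * lt z w
  lt-sucʳ = begin
    lt x y * lt z (ℤ.suc w)               ≡⟨ cong (lt x y *_) (≡.trans (lt-suc z w) (cong (_+_ (lt z w)) same)) ⟩
    lt x y * (lt z w + eq x y)            ≡⟨ ℤ.*-distribˡ-+ (lt x y) _ _ ⟩
    lt x y * lt z w + lt x y * eq x y     ≡⟨ cong (_+_ (lt x y * lt z w)) (lt*eq x y) ⟩
    lt x y * lt z w + + 0                 ≡⟨ ℤ.+-identityʳ _ ⟩
    lt x y * lt z w ∎

  lt-suc² : lt x (ℤ.suc y) * lt z (ℤ.suc w) ≡ lt x y * lt z w + eq x y
  lt-suc² = begin
    lt x (ℤ.suc y) * lt z (ℤ.suc w)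
      ≡⟨ cong₂ _*_ (lt-suc x y) (≡.trans (lt-suc z w) (cong (_+_ (lt z w)) same)) ⟩
    (lt x y + eq x y) * (lt z w + eq x y)
      ≡⟨ expand (lt x y) (eq x y) (lt z w) ⟩
    lt x y * lt z w + (lt x y * eq x y + (lt z w * eq x y + eq x y * eq x y))
      ≡⟨ cong (_+_ (lt x y * lt z w)) (cong₂ _+_ (lt*eq x y) (cong₂ _+_ vanish (eq*eq x y))) ⟩
    lt x y * lt z w + (+ 0 + (+ 0 + eq x y))
      ≡⟨ cong (_+_ (lt x y * lt z w)) (≡.trans (ℤ.+-identityˡ _) (ℤ.+-identityˡ _)) ⟩
    lt x y * lt z w + eq x y ∎
    where
    expand : ∀ a b c → (a + b) * (c + b) ≡ a * c + (a * b + (c * b + b * b))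
    expand = solve-∀

suc-neg-suc : ∀ v → ℤ.suc (- + suc v) ≡ - + v
suc-neg-suc zero    = refl
suc-neg-suc (suc v) = refl

-- The integers `v` and `−(v + 1)` with `v ≥ 0` list every integer exactly once, which is why the
-- two halves are offset. If `z` is neither 0 nor -1, dropping `v = 0` moves it one step towards
-- zero; this drives the induction.
∑-eq-+ : ∀ n z → ∣ z ∣ ℕ.< n → ∑[ v ← upTo n ] (eq z (+ v) + eq z (- + suc v)) ≡ + 1
∑-eq-+ (suc n) (+ zero) _ = begin
  ∑[ v ← upTo (suc n) ] (eq (+ 0) (+ v) + eq (+ 0) (- + suc v))
    ≡⟨ ∑-upTo-suc n (λ v → (eq (+ 0) (+ v) + eq (+ 0) (- + suc v))) ⟩
  + 1 + (∑[ v ← upTo n ] (+ 0)) ≡⟨ cong (_+_ (+ 1)) (∑-0 (upTo n)) ⟩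
  + 1 ∎
∑-eq-+ (suc n) -[1+ zero ] _ = begin
  ∑[ v ← upTo (suc n) ] (eq -[1+ 0 ] (+ v) + eq -[1+ 0 ] (- + suc v))
    ≡⟨ ∑-upTo-suc n (λ v → eq -[1+ 0 ] (+ v) + eq -[1+ 0 ] (- + suc v)) ⟩
  + 1 + (∑[ v ← upTo n ] (+ 0)) ≡⟨ cong (_+_ (+ 1)) (∑-0 (upTo n)) ⟩
  + 1 ∎
∑-eq-+ (suc n) (+ suc k) (s≤s k<n) = begin
  ∑[ v ← upTo (suc n) ] (eq (+ suc k) (+ v) + eq (+ suc k) (- + suc v))
    ≡⟨ ∑-upTo-suc n (λ v → eq (+ suc k) (+ v) + eq (+ suc k) (- + suc v)) ⟩
  + 0 + (∑[ v ← upTo n ] (eq (+ suc k) (+ suc v) + + 0))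
    ≡⟨ ≡.trans (ℤ.+-identityˡ _) (∑-ext (upTo n) (λ v → cong₂ _+_ (eq-cong {+ suc k} {+ suc v} {+ k} {+ v} (λ { refl → refl}) (λ { refl → refl })) refl)) ⟩
  ∑[ v ← upTo n ] (eq (+ k) (+ v) + eq (+ k) (- + suc v)) ≡⟨ ∑-eq-+ n (+ k) k<n ⟩
  + 1 ∎
∑-eq-+ (suc n) -[1+ suc k ] (s≤s k<n) = begin
  ∑[ v ← upTo (suc n) ] (eq -[1+ suc k ] (+ v) + eq -[1+ suc k ] (- + suc v))
    ≡⟨ ∑-upTo-suc n (λ v → eq -[1+ suc k ] (+ v) + eq -[1+ suc k ] (- + suc v)) ⟩
  + 0 + (∑[ v ← upTo n ] (+ 0 + eq -[1+ suc k ] -[1+ suc v ]))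
    ≡⟨ ≡.trans (ℤ.+-identityˡ _) (∑-ext (upTo n) (λ v → cong (_+_ (+ 0)) (eq-cong { -[1+ suc k ]} { -[1+ suc v ]} { -[1+ k ]} { -[1+ v ]} (λ { refl → refl}) (λ { refl → refl })))) ⟩
  ∑[ v ← upTo n ] (eq -[1+ k ] (+ v) + eq -[1+ k ] (- + suc v)) ≡⟨ ∑-eq-+ n -[1+ k ] k<n ⟩
  + 1 ∎

-- Sums of the keeping indicators over all places and letters

-- F⁺ and F⁻ compare P p, after renumbering, with the inserted letters v + 1 and −(v + 1).
F⁺ F⁻ : (ℕ → ℤ) → ℕ → ℕ → ℤ
F⁺ P p v = lt (P p) (+ suc v)
F⁻ P p v = lt (P p) (- + v)

Δ : (ℕ → ℕ → ℤ) → ℕ → ℕ → ℤ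
Δ F p v = F p v - F (suc p) v

descents : ℕ → (ℕ → ℤ) → ℤ
descents n P = ∑[ p ← upTo n ] lt (P (suc p)) (P p)

-- The values of `keeps` for the letters `v + 1` and `−(v + 1)` placed between `P p` and
-- `P (suc p)`, with the renumbering eliminated; see `keeps-D⁺` and `keeps-D⁻`.
D⁺ D⁻ : (ℕ → ℤ) → ℕ → ℕ → ℤ
D⁺ P p v = lt (P (suc p)) (P p) + Δ (F⁺ P) p v
D⁻ P p v = lt (P (suc p)) (P p) + Δ (F⁻ P) p v

-- A padded word: 0 in front, as in the definition of des^B, and the sentinel `n + 1` behind. A word
-- of length `n − 1` has `n` gaps, numbered by their left ends `p < n`.
record Boundary (n : ℕ) (P : ℕ → ℤ) : Set where
  field
    start : P 0 ≡ + 0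
    end   : P n ≡ + suc n
    small : ∀ p → p ℕ.< n → ∣ P p ∣ ℕ.< n

-- The bound `∣ P p ∣ ≤ n` keeps the sentinel `n + 1` out of the relation; at `p = 0` it pairs 0
-- with 0.
Inverse : ℕ → (ℕ → ℤ) → (ℕ → ℤ) → Set
Inverse n P Q = ∀ p → p ≤ n → ∣ P p ∣ ≤ n → Q ∣ P p ∣ ≡ sgnMul (P p) p

module _ {n} P Q (inv : Inverse n P Q) where

  inverse⁺ : ∀ p v → p ≤ n → v ≤ n → P p ≡ + v → Q v ≡ + p
  inverse⁺ p v p≤n v≤n P≡ =
    subst (λ z → Q ∣ z ∣ ≡ sgnMul z p) P≡ (inv p p≤n (subst (λ z → ∣ z ∣ ≤ n) (sym P≡) v≤n))

  inverse⁻ : Q 0 ≡ + 0 → ∀ p v → p ≤ n → v ≤ n → P p ≡ - + v → Q v ≡ - + p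
  -- Since `- + 0` is `+ 0`, the positive version applies, and `Q 0 ≡ + 0` forces `p = 0`.
  inverse⁻ Q0 p zero    p≤n v≤n P≡ with ≡.trans (sym Q0) (inverse⁺ p 0 p≤n v≤n P≡)
  ... | refl = Q0
  inverse⁻ Q0 p (suc v) p≤n v≤n P≡ =
    subst (λ z → Q ∣ z ∣ ≡ sgnMul z p) P≡ (inv p p≤n (subst (λ z → ∣ z ∣ ≤ n) (sym P≡) v≤n))

module Joint {n P Q} (bP : Boundary n P) (bQ : Boundary n Q) (PQ : Inverse n P Q) (QP : Inverse n Q P) where

  private
    module P = Boundary bP
    module Q = Boundary bQ

  P⁺⇒Q⁺ : ∀ p v → p ≤ n → v ≤ n → P p ≡ + v → Q v ≡ + p
  P⁺⇒Q⁺ = inverse⁺ P Q PQ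

  P⁻⇒Q⁻ : ∀ p v → p ≤ n → v ≤ n → P p ≡ - + v → Q v ≡ - + p
  P⁻⇒Q⁻ = inverse⁻ P Q PQ Q.start

  Q⁺⇒P⁺ : ∀ p v → p ≤ n → v ≤ n → Q v ≡ + p → P p ≡ + v
  Q⁺⇒P⁺ p v p≤n v≤n = inverse⁺ Q P QP v p v≤n p≤n

  Q⁻⇒P⁻ : ∀ p v → p ≤ n → v ≤ n → Q v ≡ - + p → P p ≡ - + v
  Q⁻⇒P⁻ p v p≤n v≤n = inverse⁻ Q P QP P.start v p v≤n p≤n

  P[n]≮ : ∀ {x} → x ℤ.< + suc n → lt (P n) x ≡ + 0
  P[n]≮ {x} x<1+n = ⟦⟧-false (λ P<x → ℤ.<-asym x<1+n (subst (ℤ._< x) P.end P<x)) (P n <? x)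

  Q[n]≮ : ∀ {x} → x ℤ.< + suc n → lt (Q n) x ≡ + 0
  Q[n]≮ {x} x<1+n = ⟦⟧-false (λ Q<x → ℤ.<-asym x<1+n (subst (ℤ._< x) Q.end Q<x)) (Q n <? x)

  -- Splits off a mixed second difference, whose sum dies when its potential `h` vanishes at the
  -- four corners.
  module Corner (h : ℕ → ℕ → ℤ) (h00 : h 0 0 ≡ + 0) (h0n : h 0 n ≡ + 0) (hn0 : h n 0 ≡ + 0) (hnn : h n n ≡ + 0) where

    sum : (f : ℕ → ℕ → ℤ) →
      ∑[ p ← upTo n ] ∑[ v ← upTo n ] (h p v - h p (suc v) - h (suc p) v + h (suc p) (suc v) + f p v)
        ≡ ∑[ p ← upTo n ] ∑[ v ← upTo n ] f p v
    sum f = begin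
      ∑[ p ← upTo n ] ∑[ v ← upTo n ] (h p v - h p (suc v) - h (suc p) v + h (suc p) (suc v) + f p v)
        ≡⟨ ∑-ext (upTo n) (λ p → ∑-+ (upTo n) _ (f p)) ⟩
      _ ≡⟨ ∑-+ (upTo n) _ _ ⟩
      _ ≡⟨ cong₂ _+_ (≡.trans (∑-telescope₂ n h) (cong₂ _-_ (cong₂ _-_ h00 h0n) (cong₂ _-_ hn0 hnn))) refl ⟩
      + 0 + (∑[ p ← upTo n ] ∑[ v ← upTo n ] f p v) ≡⟨ ℤ.+-identityˡ _ ⟩
      ∑[ p ← upTo n ] ∑[ v ← upTo n ] f p v ∎

  expand : ∀ a b c d → (a - b) * (c - d) ≡ a * c - a * d - b * c + b * d
  expand = solve-∀

  shuffle : ∀ a b c d e → a + e - b - c + d ≡ a - b - c + d + e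
  shuffle = solve-∀

  -- Potentials for the two bilinear sums. At `(p , v)` both factors compare with exactly `± v` and
  -- `± p`, so the equivalence of `P p ≡ ± v` and `Q v ≡ ± p` applies to them as a pair.
  H⁺ H⁻ : ℕ → ℕ → ℤ
  H⁺ p v = lt (P p) (+ v) * lt (Q v) (+ p)
  H⁻ p v = lt (P p) (- + v) * lt (Q v) (- + p)

  H⁺-n : ∀ v → v ≤ n → H⁺ n v ≡ + 0
  H⁺-n v v≤n = cong (_* lt (Q v) (+ n)) (P[n]≮ (+<+ (s≤s v≤n)))

  neg< : ∀ v → - + v ℤ.< + suc n
  neg< zero    = +<+ (s≤s z≤n)
  neg< (suc v) = -<+

  H⁻-n : ∀ v → H⁻ n v ≡ + 0
  H⁻-n v = cong (_* lt (Q v) (- + n)) (P[n]≮ (neg< v))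

  H⁺-0n : H⁺ 0 n ≡ + 0
  H⁺-0n = ≡.trans (cong (lt (P 0) (+ n) *_) (Q[n]≮ (+<+ (s≤s z≤n)))) (ℤ.*-zeroʳ (lt (P 0) (+ n)))

  H⁻-0n : H⁻ 0 n ≡ + 0
  H⁻-0n = ≡.trans (cong (lt (P 0) (- + n) *_) (Q[n]≮ (+<+ (s≤s z≤n)))) (ℤ.*-zeroʳ (lt (P 0) (- + n)))

  H-00 : H⁺ 0 0 ≡ + 0
  H-00 = cong (λ x → lt x (+ 0) * lt (Q 0) (+ 0)) P.start

  -- Of the four terms of the product, the one at `(p , v)` has both bounds one above those of `H⁺`
  -- and yields the extra `eq (P p) (+ v)`. The two mixed ones have a single bound too high, which
  -- costs nothing, and the one at `(suc p , suc v)` fits exactly.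
  joint⁺ : ∑[ p ← upTo n ] ∑[ v ← upTo n ] (Δ (F⁺ P) p v * Δ (F⁺ Q) v p)
         ≡ ∑[ p ← upTo n ] ∑[ v ← upTo n ] eq (P p) (+ v)
  joint⁺ = ≡.trans (∑-cong (upTo n) (λ p∈ → ∑-cong (upTo n) (λ v∈ → pointwise (∈-upTo⁻ p∈) (∈-upTo⁻ v∈))))
                   (Corner.sum H⁺ H-00 H⁺-0n (H⁺-n 0 z≤n) (H⁺-n n ℕ.≤-refl) _)
    where
    pointwise : ∀ {p v} → p ℕ.< n → v ℕ.< n →
      Δ (F⁺ P) p v * Δ (F⁺ Q) v p ≡ H⁺ p v - H⁺ p (suc v) - H⁺ (suc p) v + H⁺ (suc p) (suc v) + eq (P p) (+ v)
    pointwise {p} {v} p<n v<n = begin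
      Δ (F⁺ P) p v * Δ (F⁺ Q) v p
        ≡⟨ expand (F⁺ P p v) (F⁺ P (suc p) v) (F⁺ Q v p) (F⁺ Q (suc v) p) ⟩
      F⁺ P p v * F⁺ Q v p - F⁺ P p v * F⁺ Q (suc v) p - F⁺ P (suc p) v * F⁺ Q v p + F⁺ P (suc p) v * F⁺ Q (suc v) p
        ≡⟨ cong₂ _+_ (cong₂ _-_ (cong₂ _-_
             (lt-suc² (P⁺⇒Q⁺ p v p≤n v≤n) (Q⁺⇒P⁺ p v p≤n v≤n))
             (lt-sucʳ (P⁺⇒Q⁺ p (suc v) p≤n v<n) (Q⁺⇒P⁺ p (suc v) p≤n v<n)))
             (lt-sucˡ (P⁺⇒Q⁺ (suc p) v p<n v≤n) (Q⁺⇒P⁺ (suc p) v p<n v≤n))) refl ⟩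
      H⁺ p v + eq (P p) (+ v) - H⁺ p (suc v) - H⁺ (suc p) v + H⁺ (suc p) (suc v)
        ≡⟨ shuffle (H⁺ p v) _ _ _ _ ⟩
      H⁺ p v - H⁺ p (suc v) - H⁺ (suc p) v + H⁺ (suc p) (suc v) + eq (P p) (+ v) ∎
      where
      p≤n = ℕ.<⇒≤ p<n
      v≤n = ℕ.<⇒≤ v<n

  -- The mirror image: for negative bounds the term at `(p , v)` fits exactly, and the excess
  -- appears at `(suc p , suc v)`.
  joint⁻ : ∑[ p ← upTo n ] ∑[ v ← upTo n ] (Δ (F⁻ P) p v * Δ (F⁻ Q) v p)
         ≡ ∑[ p ← upTo n ] ∑[ v ← upTo n ] eq (P (suc p)) (- + suc v)
  joint⁻ = ≡.trans (∑-cong (upTo n) (λ p∈ → ∑-cong (upTo n) (λ v∈ → pointwise (∈-upTo⁻ p∈) (∈-upTo⁻ v∈))))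
                   -- `H-00` serves here too: `- + 0` computes to `+ 0`, so `H⁻ 0 0` and `H⁺ 0 0`
                   -- coincide.
                   (Corner.sum H⁻ H-00 H⁻-0n (H⁻-n 0) (H⁻-n n) _)
    where
    pointwise : ∀ {p v} → p ℕ.< n → v ℕ.< n →
      Δ (F⁻ P) p v * Δ (F⁻ Q) v p
        ≡ H⁻ p v - H⁻ p (suc v) - H⁻ (suc p) v + H⁻ (suc p) (suc v) + eq (P (suc p)) (- + suc v)
    pointwise {p} {v} p<n v<n = begin
      Δ (F⁻ P) p v * Δ (F⁻ Q) v p
        ≡⟨ expand (F⁻ P p v) (F⁻ P (suc p) v) (F⁻ Q v p) (F⁻ Q (suc v) p) ⟩
      F⁻ P p v * F⁻ Q v p - F⁻ P p v * F⁻ Q (suc v) p - F⁻ P (suc p) v * F⁻ Q v p + F⁻ P (suc p) v * F⁻ Q (suc v) p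
        ≡⟨ cong₂ _+_ (cong₂ _-_ (cong₂ _-_ (refl {x = H⁻ p v})
             -- Reading `− v` as the successor of `−(v + 1)` exposes the raised bound that the
             -- successor lemmas expect.
             (≡.trans (cong (λ y → lt (P p) y * F⁻ Q (suc v) p) (sym (suc-neg-suc v)))
                      (lt-sucˡ (P⁻⇒Q⁻ p (suc v) p≤n v<n) (Q⁻⇒P⁻ p (suc v) p≤n v<n))))
             (≡.trans (cong (λ y → F⁻ P (suc p) v * lt (Q v) y) (sym (suc-neg-suc p)))
                      (lt-sucʳ (P⁻⇒Q⁻ (suc p) v p<n v≤n) (Q⁻⇒P⁻ (suc p) v p<n v≤n))))
             (≡.trans (cong₂ (λ x y → lt (P (suc p)) x * lt (Q (suc v)) y) (sym (suc-neg-suc v)) (sym (suc-neg-suc p)))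
                      (lt-suc² (P⁻⇒Q⁻ (suc p) (suc v) p<n v<n) (Q⁻⇒P⁻ (suc p) (suc v) p<n v<n))) ⟩
      H⁻ p v - H⁻ p (suc v) - H⁻ (suc p) v + (H⁻ (suc p) (suc v) + eq (P (suc p)) (- + suc v))
        ≡⟨ ℤ.+-assoc (H⁻ p v - H⁻ p (suc v) - H⁻ (suc p) v) _ _ ⟨
      H⁻ p v - H⁻ p (suc v) - H⁻ (suc p) v + H⁻ (suc p) (suc v) + eq (P (suc p)) (- + suc v) ∎
      where
      p≤n = ℕ.<⇒≤ p<n
      v≤n = ℕ.<⇒≤ v<n

  -- The row count `N p` vanishes at both ends, where `P` is 0 and `n + 1`, so shifting the index
  -- changes nothing. Afterwards positive and negative matches refer to the same row, as `∑-eq-+`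
  -- requires.
  negatives-shift : ∑[ p ← upTo n ] ∑[ v ← upTo n ] eq (P (suc p)) (- + suc v)
                  ≡ ∑[ p ← upTo n ] ∑[ v ← upTo n ] eq (P p) (- + suc v)
  negatives-shift = ℤ.i-j≡0⇒i≡j _ _ (begin
    _ ≡⟨ ∑-minus (upTo n) _ _ ⟨
    ∑[ p ← upTo n ] (N (suc p) - N p)           ≡⟨ ∑-ext (upTo n) (λ p → flip (N (suc p)) (N p)) ⟩
    ∑[ p ← upTo n ] (- N p - - N (suc p))       ≡⟨ ∑-telescope n (λ p → - N p) ⟩
    - N 0 - - N n                               ≡⟨ cong₂ (λ x y → - x - - y) N0 Nn ⟩
    + 0 ∎)
    where
    N : ℕ → ℤ
    N p = ∑[ v ← upTo n ] eq (P p) (- + suc v)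
    flip : ∀ a b → a - b ≡ - b - - a
    flip = solve-∀
    N0 : N 0 ≡ + 0
    N0 = ≡.trans (∑-ext (upTo n) (λ v → cong (λ x → eq x (- + suc v)) P.start)) (∑-0 (upTo n))
    Nn : N n ≡ + 0
    Nn = ≡.trans (∑-ext (upTo n) (λ v → cong (λ x → eq x (- + suc v)) P.end)) (∑-0 (upTo n))

  -- Each row `p < n` contains exactly one match; in row 0 it is `v = 0`.
  joint : ∑[ p ← upTo n ] ∑[ v ← upTo n ] (Δ (F⁺ P) p v * Δ (F⁺ Q) v p + Δ (F⁻ P) p v * Δ (F⁻ Q) v p) ≡ + n
  joint = begin
    ∑[ p ← upTo n ] ∑[ v ← upTo n ] (Δ (F⁺ P) p v * Δ (F⁺ Q) v p + Δ (F⁻ P) p v * Δ (F⁻ Q) v p)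
      ≡⟨ ∑₂-+ (upTo n) (upTo n) _ _ ⟩
    _ ≡⟨ cong₂ _+_ joint⁺ (≡.trans joint⁻ negatives-shift) ⟩
    _ ≡⟨ ∑₂-+ (upTo n) (upTo n) _ _ ⟨
    ∑[ p ← upTo n ] ∑[ v ← upTo n ] (eq (P p) (+ v) + eq (P p) (- + suc v))
      ≡⟨ ∑-cong (upTo n) (λ p∈ → ∑-eq-+ n (P _) (P.small _ (∈-upTo⁻ p∈))) ⟩
    ∑[ p ← upTo n ] + 1
      ≡⟨ ∑-const (upTo n) (+ 1) ⟩
    + length (upTo n) * + 1
      ≡⟨ ≡.trans (ℤ.*-identityʳ _) (cong +_ (length-upTo n)) ⟩
    + n ∎

  -- Telescoping in `p` leaves four boundary comparisons, of which only `0 < v + 1` is true.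
  ∑-Δ : ∀ {P} → Boundary n P → ∀ {v} → v ℕ.< n → ∑[ p ← upTo n ] (Δ (F⁺ P) p v + Δ (F⁻ P) p v) ≡ + 1
  ∑-Δ {P} bP {v} v<n = begin
    ∑[ p ← upTo n ] (Δ (F⁺ P) p v + Δ (F⁻ P) p v)
      ≡⟨ ∑-+ (upTo n) _ _ ⟩
    _ ≡⟨ cong₂ _+_ (∑-telescope n (λ p → F⁺ P p v)) (∑-telescope n (λ p → F⁻ P p v)) ⟩
    (F⁺ P 0 v - F⁺ P n v) + (F⁻ P 0 v - F⁻ P n v)
      ≡⟨ cong₂ (λ x y → (lt x (+ suc v) - lt y (+ suc v)) + (lt x (- + v) - lt y (- + v)))
               (Boundary.start bP) (Boundary.end bP) ⟩
    (lt (+ 0) (+ suc v) - lt (+ suc n) (+ suc v)) + (lt (+ 0) (- + v) - lt (+ suc n) (- + v))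
      ≡⟨ cong₂ _+_ (cong₂ _-_ (⟦⟧-true (+<+ (s≤s z≤n)) (+ 0 <? + suc v))
                              (⟦⟧-false (λ { (+<+ (s≤s n<v)) → ℕ.<-asym n<v v<n }) (+ suc n <? + suc v)))
                   (cong₂ _-_ (⟦⟧-false (nonneg≮neg v) (+ 0 <? - + v)) (⟦⟧-false (nonneg≮neg v) (+ suc n <? - + v))) ⟩
    + 1 ∎
    where
    nonneg≮neg : ∀ {k} v → ¬ (+ k ℤ.< - + v)
    nonneg≮neg zero (+<+ ())
    nonneg≮neg (suc v) ()

  ∑-D : ∀ {P} → Boundary n P → ∑[ p ← upTo n ] ∑[ v ← upTo n ] (D⁺ P p v + D⁻ P p v) ≡ + 2 * + n * descents n P + + n
  ∑-D {P} bP = begin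
    ∑[ p ← upTo n ] ∑[ v ← upTo n ] (D⁺ P p v + D⁻ P p v)
      ≡⟨ ∑-swap (upTo n) (upTo n) _ ⟩
    ∑[ v ← upTo n ] ∑[ p ← upTo n ] (D⁺ P p v + D⁻ P p v)
      ≡⟨ ∑-cong (upTo n) (λ v∈ → row (∈-upTo⁻ v∈)) ⟩
    ∑[ v ← upTo n ] (+ 2 * descents n P + + 1)
      ≡⟨ ∑-const (upTo n) _ ⟩
    + length (upTo n) * (+ 2 * descents n P + + 1)
      ≡⟨ cong (λ k → + k * (+ 2 * descents n P + + 1)) (length-upTo n) ⟩
    + n * (+ 2 * descents n P + + 1)
      ≡⟨ regroup (+ n) (descents n P) ⟩
    + 2 * + n * descents n P + + n ∎
    where
    regroup : ∀ n d → n * (+ 2 * d + + 1) ≡ + 2 * n * d + n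
    regroup = solve-∀
    split : ∀ a x y → (a + x) + (a + y) ≡ + 2 * a + (x + y)
    split = solve-∀
    row : ∀ {v} → v ℕ.< n → ∑[ p ← upTo n ] (D⁺ P p v + D⁻ P p v) ≡ + 2 * descents n P + + 1
    row {v} v<n = begin
      ∑[ p ← upTo n ] (D⁺ P p v + D⁻ P p v)
        ≡⟨ ∑-ext (upTo n) (λ p → split (lt (P (suc p)) (P p)) (Δ (F⁺ P) p v) (Δ (F⁻ P) p v)) ⟩
      _ ≡⟨ ∑-+ (upTo n) _ _ ⟩
      _ ≡⟨ cong₂ _+_ (∑-*ˡ (upTo n) (+ 2) _) (∑-Δ bP v<n) ⟩
      + 2 * descents n P + + 1 ∎

  -- This total becomes the first coefficient of the recurrence. Expanding gives the product of the
  -- two descent numbers, two mixed sums that `∑-Δ` collapses, and the bilinear sum `joint`.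
  ∑-D*D : ∑[ p ← upTo n ] ∑[ v ← upTo n ] (D⁺ P p v * D⁺ Q v p + D⁻ P p v * D⁻ Q v p)
        ≡ + n + descents n P + descents n Q + + 2 * descents n P * descents n Q
  ∑-D*D = begin
    ∑[ p ← upTo n ] ∑[ v ← upTo n ] (D⁺ P p v * D⁺ Q v p + D⁻ P p v * D⁻ Q v p)
      ≡⟨ ∑₂-ext (upTo n) (upTo n) (λ p v → split (d p) (e v) (Δ (F⁺ P) p v) (Δ (F⁻ P) p v) (Δ (F⁺ Q) v p) (Δ (F⁻ Q) v p)) ⟩
    ∑[ p ← upTo n ] ∑[ v ← upTo n ] ((+ 2 * d p) * e v + (d p * q p v + e v * r p v) + s p v)
      ≡⟨ ≡.trans (+-split (λ p v → (+ 2 * d p) * e v + (d p * q p v + e v * r p v)) s) (cong₂ _+_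
           (≡.trans (+-split (λ p v → (+ 2 * d p) * e v) (λ p v → d p * q p v + e v * r p v)) (cong₂ _+_ product
             (≡.trans (+-split (λ p v → d p * q p v) (λ p v → e v * r p v)) (cong₂ _+_ left right)))) joint) ⟩
    + 2 * descents n P * descents n Q + (descents n P + descents n Q) + + n
      ≡⟨ regroup (+ n) (descents n P) (descents n Q) ⟩
    + n + descents n P + descents n Q + + 2 * descents n P * descents n Q ∎
    where
    d e : ℕ → ℤ
    d p = lt (P (suc p)) (P p)
    e v = lt (Q (suc v)) (Q v)
    q r s : ℕ → ℕ → ℤ
    q p v = Δ (F⁺ Q) v p + Δ (F⁻ Q) v p
    r p v = Δ (F⁺ P) p v + Δ (F⁻ P) p v
    s p v = Δ (F⁺ P) p v * Δ (F⁺ Q) v p + Δ (F⁻ P) p v * Δ (F⁻ Q) v p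
    split : ∀ a b x x′ y y′ → (a + x) * (b + y) + (a + x′) * (b + y′)
                            ≡ (+ 2 * a) * b + (a * (y + y′) + b * (x + x′)) + (x * y + x′ * y′)
    split = solve-∀
    regroup : ∀ n d e → + 2 * d * e + (d + e) + n ≡ n + d + e + + 2 * d * e
    regroup = solve-∀
    +-split = ∑₂-+ (upTo n) (upTo n)
    product : ∑[ p ← upTo n ] ∑[ v ← upTo n ] ((+ 2 * d p) * e v) ≡ + 2 * descents n P * descents n Q
    product = begin
      ∑[ p ← upTo n ] ∑[ v ← upTo n ] ((+ 2 * d p) * e v)
        ≡⟨ ∑-ext (upTo n) (λ p → ≡.trans (∑-*ˡ (upTo n) (+ 2 * d p) e) (ℤ.*-comm (+ 2 * d p) _)) ⟩
      ∑[ p ← upTo n ] (descents n Q * (+ 2 * d p))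
        ≡⟨ ≡.trans (∑-*ˡ (upTo n) (descents n Q) _) (cong (descents n Q *_) (∑-*ˡ (upTo n) (+ 2) d)) ⟩
      descents n Q * (+ 2 * descents n P)
        ≡⟨ ℤ.*-comm (descents n Q) _ ⟩
      + 2 * descents n P * descents n Q ∎
    left : ∑[ p ← upTo n ] ∑[ v ← upTo n ] (d p * q p v) ≡ descents n P
    left = ∑-cong (upTo n) (λ {p} p∈ → ≡.trans (∑-*ˡ (upTo n) (d p) (q p))
             (≡.trans (cong (d p *_) (∑-Δ bQ (∈-upTo⁻ p∈))) (ℤ.*-identityʳ (d p))))
    right : ∑[ p ← upTo n ] ∑[ v ← upTo n ] (e v * r p v) ≡ descents n Q
    right = ≡.trans (∑-swap (upTo n) (upTo n) _)
      (∑-cong (upTo n) (λ {v} v∈ → ≡.trans (∑-*ˡ (upTo n) (e v) (λ p → r p v))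
             (≡.trans (cong (e v *_) (∑-Δ bP (∈-upTo⁻ v∈))) (ℤ.*-identityʳ (e v)))))

-- Renumbering around an inserted letter

-- Renumbers values to make room for v.
upℕ : ℕ → ℕ → ℕ
upℕ zero    k       = suc k
upℕ (suc v) zero    = zero
upℕ (suc v) (suc k) = suc (upℕ v k)

upℕ-< : ∀ {v k} → k ℕ.< v → upℕ v k ≡ k
upℕ-< {suc v} {zero}  _         = refl
upℕ-< {suc v} {suc k} (s≤s k<v) = cong suc (upℕ-< k<v)

upℕ-≥ : ∀ {v k} → v ≤ k → upℕ v k ≡ suc k
upℕ-≥ z≤n       = refl
upℕ-≥ (s≤s v≤k) = cong suc (upℕ-≥ v≤k)

upℕ≢ : ∀ v k → upℕ v k ≢ v
upℕ≢ (suc v) (suc k) eq = upℕ≢ v k (ℕ.suc-injective eq)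

upℕ-mono : ∀ v {j k} → j ℕ.< k → upℕ v j ℕ.< upℕ v k
upℕ-mono zero    j<k                   = s≤s j<k
upℕ-mono (suc v) {zero}  (s≤s j<k)     = s≤s z≤n
upℕ-mono (suc v) {suc j} (s≤s j<k)     = s≤s (upℕ-mono v j<k)

upℕ-injective : ∀ v {j k} → upℕ v j ≡ upℕ v k → j ≡ k
upℕ-injective v {j} {k} eq with ℕ.<-cmp j k
... | tri< j<k _ _ = contradiction eq (ℕ.<⇒≢ (upℕ-mono v j<k))
... | tri≈ _ j≡k _ = j≡k
... | tri> _ _ k<j = contradiction (sym eq) (ℕ.<⇒≢ (upℕ-mono v k<j))

upℕ-<⁺ : ∀ {v k} → k ℕ.< v → upℕ v k ℕ.< v
upℕ-<⁺ k<v = subst (ℕ._< _) (sym (upℕ-< k<v)) k<v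

upℕ-<⁻ : ∀ {v k} → upℕ v k ℕ.< v → k ℕ.< v
upℕ-<⁻ {v} {k} up<v with k ℕ.<? v
... | yes k<v = k<v
... | no  k≮v = contradiction (subst (ℕ._< v) (upℕ-≥ (ℕ.≮⇒≥ k≮v)) up<v) (k≮v ∘ ℕ.m+n≤o⇒n≤o 1)

upℕ-≥⁺ : ∀ {v k} → v ≤ k → v ℕ.< upℕ v k
upℕ-≥⁺ v≤k = subst (_ ℕ.<_) (sym (upℕ-≥ v≤k)) (s≤s v≤k)

upℕ-≥⁻ : ∀ {v k} → v ℕ.< upℕ v k → v ≤ k
upℕ-≥⁻ {v} {k} v<up with k ℕ.<? v
... | yes k<v = contradiction (subst (v ℕ.<_) (upℕ-< k<v) v<up) (ℕ.<-asym k<v)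
... | no  k≮v = ℕ.≮⇒≥ k≮v

upℕ-surjective : ∀ v k → k ≢ v → ∃ λ j → upℕ v j ≡ k
upℕ-surjective zero    zero    k≢v = contradiction refl k≢v
upℕ-surjective zero    (suc k) k≢v = k , refl
upℕ-surjective (suc v) zero    k≢v = zero , refl
upℕ-surjective (suc v) (suc k) k≢v with upℕ-surjective v k (k≢v ∘ cong suc)
... | j , eq = suc j , cong suc eq

-- Makes room for ±(v + 1): places and absolute values are indexed from 0, as in letters.
up : ℕ → ℤ → ℤ
up v (+ k)    = + upℕ (suc v) k
up v -[1+ k ] = -[1+ upℕ v k ]

∣up∣ : ∀ v x → ∣ up v x ∣ ≡ upℕ (suc v) ∣ x ∣
∣up∣ v (+ k)    = refl
∣up∣ v -[1+ k ] = refl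

∣up∣≢ : ∀ v x → ∣ up v x ∣ ≢ suc v
∣up∣≢ v x eq = upℕ≢ (suc v) ∣ x ∣ (≡.trans (sym (∣up∣ v x)) eq)

up-mono : ∀ v {x y} → x ℤ.< y → up v x ℤ.< up v y
up-mono v (-<- j<k) = -<- (upℕ-mono v j<k)
up-mono v -<+       = -<+
up-mono v (+<+ j<k) = +<+ (upℕ-mono (suc v) j<k)

up-reflects-< : ∀ v {x y} → up v x ℤ.< up v y → x ℤ.< y
up-reflects-< v {x} {y} ux<uy with ℤ.<-cmp x y
... | tri< x<y _ _ = x<y
... | tri≈ _ refl _ = contradiction ux<uy (ℤ.<-irrefl refl)
... | tri> _ _ y<x = contradiction ux<uy (ℤ.<-asym (up-mono v y<x))

up-injective : ∀ v {x y} → up v x ≡ up v y → x ≡ y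
up-injective v {+ j}      {+ k}      eq = cong +_ (upℕ-injective (suc v) (ℤ.+-injective eq))
up-injective v { -[1+ j ]} { -[1+ k ]} eq = cong -[1+_] (upℕ-injective v (ℤ.-[1+-injective eq))

lt-up : ∀ v x y → lt (up v x) (up v y) ≡ lt x y
lt-up v x y = lt-cong (up-reflects-< v) (up-mono v)

lt-up-pos : ∀ v x → lt (up v x) (+ suc v) ≡ lt x (+ suc v)
lt-up-pos v (+ k)    = lt-cong (λ { (+<+ l) → +<+ (upℕ-<⁻ l) }) (λ { (+<+ l) → +<+ (upℕ-<⁺ l) })
lt-up-pos v -[1+ k ] = refl

-- The bound is `− v` and not `−(v + 1)` because renumbering pushes `−(v + 1)` itself below the
-- inserted letter.
lt-up-neg : ∀ v x → lt (up v x) -[1+ v ] ≡ lt x (- + v)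
lt-up-neg zero    (+ k)    = refl
lt-up-neg (suc v) (+ k)    = refl
lt-up-neg zero    -[1+ k ] = refl
lt-up-neg (suc v) -[1+ k ] = lt-cong (λ { (-<- l) → -<- (upℕ-≥⁻ l) }) (λ { (-<- l) → -<- (upℕ-≥⁺ l) })

-- Insertion of a letter and its effect on descents

insert : {A : Set} → ℕ → A → List A → List A
insert zero    x ys       = x ∷ ys
insert (suc p) x []       = x ∷ []
insert (suc p) x (y ∷ ys) = y ∷ insert p x ys

-- Pads the word with `a` in front and `∞` at every index past the end, so that `insert p` fills the
-- gap between the padded indices `p` and `suc p`.
at : ℤ → ℤ → List ℤ → ℕ → ℤ
at ∞ a w       zero    = a
at ∞ a []      (suc k) = ∞
at ∞ a (b ∷ w) (suc k) = at ∞ b w k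

at-length : ∀ ∞ a w → at ∞ a w (suc (length w)) ≡ ∞
at-length ∞ a []      = refl
at-length ∞ a (b ∷ w) = at-length ∞ b w

desFrom-∷ : ∀ a b w → + desFrom a (b ∷ w) ≡ lt b a + + desFrom b w
desFrom-∷ a b w with b <? a
... | yes _ = refl
... | no _  = refl

desFrom-map-up : ∀ v a w → desFrom (up v a) (map (up v) w) ≡ desFrom a w
desFrom-map-up v a []      = refl
desFrom-map-up v a (b ∷ w) = ℤ.+-injective (begin
  + desFrom (up v a) (up v b ∷ map (up v) w)               ≡⟨ desFrom-∷ (up v a) (up v b) (map (up v) w) ⟩
  lt (up v b) (up v a) + + desFrom (up v b) (map (up v) w) ≡⟨ cong₂ (λ l k → l + + k) (lt-up v b a) (desFrom-map-up v b w) ⟩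
  lt b a + + desFrom b w                                   ≡⟨ desFrom-∷ a b w ⟨
  + desFrom a (b ∷ w) ∎)

-- The sum covers one gap more than `desFrom` inspects; that gap ends at the maximal `∞` and is no
-- descent.
∑-lt-at : ∀ ∞ a w → All (ℤ._≤ ∞) (a ∷ w) →
  ∑[ p ← upTo (suc (length w)) ] lt (at ∞ a w (suc p)) (at ∞ a w p) ≡ + desFrom a w
∑-lt-at ∞ a []      (a≤∞ ∷ [])  = ≡.trans (ℤ.+-identityʳ _) (⟦⟧-false (ℤ.≤⇒≯ a≤∞) (∞ <? a))
∑-lt-at ∞ a (b ∷ w) (a≤∞ ∷ w≤∞) = begin
  ∑[ p ← upTo (suc (suc (length w))) ] lt (at ∞ a (b ∷ w) (suc p)) (at ∞ a (b ∷ w) p)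
    ≡⟨ ∑-upTo-suc (suc (length w)) (λ p → lt (at ∞ a (b ∷ w) (suc p)) (at ∞ a (b ∷ w) p)) ⟩
  lt b a + (∑[ p ← upTo (suc (length w)) ] lt (at ∞ b w (suc p)) (at ∞ b w p))
    ≡⟨ cong (_+_ (lt b a)) (∑-lt-at ∞ b w w≤∞) ⟩
  lt b a + + desFrom b w
    ≡⟨ desFrom-∷ a b w ⟨
  + desFrom a (b ∷ w) ∎

-- 1 if inserting x between a and b keeps the number of descents, 0 if it creates one.
keeps : ℕ → ℤ → ℤ → ℤ → ℤ
keeps v x a b = lt b a + (lt (up v a) x - lt (up v b) x)

lt-flip : ∀ x y → x ≢ y → lt x y ≡ + 1 - lt y x
lt-flip x y x≢y with ℤ.<-cmp x y
... | tri< x<y _ x≯y = ≡.trans (⟦⟧-true x<y (x <? y)) (cong (λ z → + 1 - z) (sym (⟦⟧-false x≯y (y <? x))))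
... | tri≈ _ x≡y _ = contradiction x≡y x≢y
... | tri> x≮y _ x>y = ≡.trans (⟦⟧-false x≮y (x <? y)) (cong (λ z → + 1 - z) (sym (⟦⟧-true x>y (y <? x))))

up≢ : ∀ {v x} → ∣ x ∣ ≡ suc v → ∀ a → x ≢ up v a
up≢ {v} ∣x∣≡1+v a refl = ∣up∣≢ v a ∣x∣≡1+v

-- The term `[b < a]` is replaced by `[x < a] + [b < x]` with `a` and `b` renumbered. Since `x`
-- differs from `up v a`, the first summand is `1 − [a < x]`, which yields `1 − keeps`. All other
-- comparisons survive renumbering.
desFrom-insert : ∀ ∞ {v x} → ∣ x ∣ ≡ suc v → x ℤ.< up v ∞ →
  ∀ p a w → All (ℤ._≤ ∞) (a ∷ w) → p ≤ length w →
  + desFrom (up v a) (insert p x (map (up v) w)) ≡ + desFrom a w + + 1 - keeps v x (at ∞ a w p) (at ∞ a w (suc p))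
-- At the end of the word the right neighbour is `∞`, and both comparisons that involve it are
-- false.
desFrom-insert ∞ {v} {x} ∣x∣ x<∞ zero a [] (a≤∞ ∷ []) _ = begin
  + desFrom (up v a) (x ∷ [])       ≡⟨ desFrom-∷ (up v a) x [] ⟩
  lt x (up v a) + + 0               ≡⟨ cong (_+ + 0) (lt-flip x (up v a) (up≢ ∣x∣ a)) ⟩
  + 1 - lt (up v a) x + + 0         ≡⟨ regroup (lt (up v a) x) ⟩
  + 0 + + 1 - (+ 0 + (lt (up v a) x - + 0))
    ≡⟨ cong₂ (λ i j → + 0 + + 1 - (i + (lt (up v a) x - j))) (⟦⟧-false (ℤ.≤⇒≯ a≤∞) (∞ <? a)) (⟦⟧-false (ℤ.<-asym x<∞) (up v ∞ <? x)) ⟨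
  + 0 + + 1 - keeps v x a ∞ ∎
  where
  regroup : ∀ a → + 1 - a + + 0 ≡ + 0 + + 1 - (+ 0 + (a - + 0))
  regroup = solve-∀
desFrom-insert ∞ {v} {x} ∣x∣ x<∞ zero a (b ∷ w) _ _ = begin
  + desFrom (up v a) (x ∷ up v b ∷ map (up v) w)
    ≡⟨ ≡.trans (desFrom-∷ (up v a) x (up v b ∷ map (up v) w)) (cong (_+_ (lt x (up v a))) (desFrom-∷ x (up v b) (map (up v) w))) ⟩
  lt x (up v a) + (lt (up v b) x + + desFrom (up v b) (map (up v) w))
    ≡⟨ cong₂ (λ l k → l + (lt (up v b) x + + k)) (lt-flip x (up v a) (up≢ ∣x∣ a)) (desFrom-map-up v b w) ⟩
  (+ 1 - lt (up v a) x) + (lt (up v b) x + + desFrom b w)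
    ≡⟨ regroup (lt (up v a) x) (lt (up v b) x) (lt b a) (+ desFrom b w) ⟩
  (lt b a + + desFrom b w) + + 1 - keeps v x a b
    ≡⟨ cong (λ k → k + + 1 - keeps v x a b) (desFrom-∷ a b w) ⟨
  + desFrom a (b ∷ w) + + 1 - keeps v x a b ∎
  where
  regroup : ∀ i j l k → (+ 1 - i) + (j + k) ≡ (l + k) + + 1 - (l + (i - j))
  regroup = solve-∀
desFrom-insert ∞ {v} {x} ∣x∣ x<∞ (suc p) a (b ∷ w) (_ ∷ w≤∞) (s≤s p≤) = begin
  + desFrom (up v a) (up v b ∷ insert p x (map (up v) w))
    ≡⟨ desFrom-∷ (up v a) (up v b) _ ⟩
  lt (up v b) (up v a) + + desFrom (up v b) (insert p x (map (up v) w))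
    ≡⟨ cong₂ _+_ (lt-up v b a) (desFrom-insert ∞ ∣x∣ x<∞ p b w w≤∞ p≤) ⟩
  lt b a + (+ desFrom b w + + 1 - K)
    ≡⟨ regroup (lt b a) (+ desFrom b w) K ⟩
  (lt b a + + desFrom b w) + + 1 - K
    ≡⟨ cong (λ k → k + + 1 - K) (desFrom-∷ a b w) ⟨
  + desFrom a (b ∷ w) + + 1 - K ∎
  where
  K = keeps v x (at ∞ b w p) (at ∞ b w (suc p))
  regroup : ∀ l d k → l + (d + + 1 - k) ≡ (l + d) + + 1 - k
  regroup = solve-∀

-- The truth patterns that would give 2 or -1 contradict the monotonicity of `up v`.
keeps-0∨1 : ∀ v x a b → keeps v x a b ≡ + 0 ⊎ keeps v x a b ≡ + 1
keeps-0∨1 v x a b with b <? a | up v a <? x | up v b <? x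
... | yes _   | yes _    | yes _    = inj₂ refl
... | yes b<a | yes ua<x | no  ub≮x = contradiction (ℤ.<-trans (up-mono v b<a) ua<x) ub≮x
... | yes _   | no _     | yes _    = inj₁ refl
... | yes _   | no _     | no _     = inj₂ refl
... | no _    | yes _    | yes _    = inj₁ refl
... | no _    | yes _    | no _     = inj₂ refl
... | no b≮a  | no ua≮x  | yes ub<x with ℤ.<-cmp a b
...   | tri< a<b _ _  = contradiction (ℤ.<-trans (up-mono v a<b) ub<x) ua≮x
...   | tri≈ _ refl _ = contradiction ub<x ua≮x
...   | tri> _ _ b<a  = contradiction b<a b≮a
keeps-0∨1 v x a b | no _ | no _ | no _ = inj₁ refl

-- Inverses of words

sgnMul-up : ∀ v y i → sgnMul (up v y) i ≡ sgnMul y i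
sgnMul-up v (+ k)    i = refl
sgnMul-up v -[1+ k ] i = refl

up-sgnMul-≥ : ∀ {t s} y → t ≤ s → up t (sgnMul y (suc s)) ≡ sgnMul y (suc (suc s))
up-sgnMul-≥ (+ _)    t≤s = cong (+_ ∘ suc) (upℕ-≥ t≤s)
up-sgnMul-≥ -[1+ _ ] t≤s = cong -[1+_] (upℕ-≥ t≤s)

up-sgnMul-< : ∀ {t s} y → s ℕ.< t → up t (sgnMul y (suc s)) ≡ sgnMul y (suc s)
up-sgnMul-< (+ _)    s<t = cong (+_ ∘ suc) (upℕ-< s<t)
up-sgnMul-< -[1+ _ ] s<t = cong -[1+_] (upℕ-< s<t)

∣up∣-hit⁺ : ∀ {v k} y → ∣ y ∣ ≡ suc k → ∣ up v y ∣ ≡ suc (upℕ v k)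
∣up∣-hit⁺ {v} y eq = ≡.trans (∣up∣ v y) (cong (upℕ (suc v)) eq)

∣up∣-hit⁻ : ∀ {v k} y → ∣ up v y ∣ ≡ suc (upℕ v k) → ∣ y ∣ ≡ suc k
∣up∣-hit⁻ {v} y eq = upℕ-injective (suc v) (≡.trans (sym (∣up∣ v y)) eq)

-- All positions searched lie beyond `t`, so `up t` is precisely their shift by one. A failed search
-- returns 0, which `up t` fixes.
invAt-map-up : ∀ v k {t s} w → t ≤ s →
  invAt (suc (upℕ v k)) (suc (suc s)) (map (up v) w) ≡ up t (invAt (suc k) (suc s) w)
invAt-map-up v k []      t≤s = refl
invAt-map-up v k (y ∷ w) t≤s with ∣ up v y ∣ ℕ.≟ suc (upℕ v k) | ∣ y ∣ ℕ.≟ suc k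
... | yes _  | yes _  = ≡.trans (sgnMul-up v y _) (sym (up-sgnMul-≥ y t≤s))
... | yes eq | no ≢   = contradiction (∣up∣-hit⁻ y eq) ≢
... | no ≢   | yes eq = contradiction (∣up∣-hit⁺ y eq) ≢
... | no _   | no _   = invAt-map-up v k w (ℕ.m≤n⇒m≤1+n t≤s)

-- Letters before place `p` keep their positions and later ones move by one; `up (s + p)` does both
-- to the signed position, `s` being the number of letters already passed.
invAt-insert-other : ∀ {v x} → ∣ x ∣ ≡ suc v → ∀ k s p w →
  invAt (suc (upℕ v k)) (suc s) (insert p x (map (up v) w)) ≡ up (s ℕ.+ p) (invAt (suc k) (suc s) w)
invAt-insert-other {v} {x} ∣x∣ k s zero w with ∣ x ∣ ℕ.≟ suc (upℕ v k)
... | yes eq = contradiction (≡.trans (sym eq) ∣x∣) (upℕ≢ (suc v) (suc k))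
... | no _   = invAt-map-up v k w (ℕ.≤-reflexive (ℕ.+-identityʳ s))
invAt-insert-other {v} {x} ∣x∣ k s (suc p) [] with ∣ x ∣ ℕ.≟ suc (upℕ v k)
... | yes eq = contradiction (≡.trans (sym eq) ∣x∣) (upℕ≢ (suc v) (suc k))
... | no _   = refl
invAt-insert-other {v} ∣x∣ k s (suc p) (y ∷ w) with ∣ up v y ∣ ℕ.≟ suc (upℕ v k) | ∣ y ∣ ℕ.≟ suc k
... | yes _  | yes _  = ≡.trans (sgnMul-up v y _) (sym (up-sgnMul-< y (ℕ.m<m+n s (s≤s z≤n))))
... | yes eq | no ≢   = contradiction (∣up∣-hit⁻ y eq) ≢
... | no ≢   | yes eq = contradiction (∣up∣-hit⁺ y eq) ≢
... | no _   | no _   = ≡.trans (invAt-insert-other ∣x∣ k (suc s) p w)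
                                (cong (λ t → up t (invAt (suc k) (suc (suc s)) w)) (sym (ℕ.+-suc s p)))

invAt-insert-self : ∀ {v x} → ∣ x ∣ ≡ suc v → ∀ s p w → p ≤ length w →
  invAt (suc v) (suc s) (insert p x (map (up v) w)) ≡ sgnMul x (suc (s ℕ.+ p))
invAt-insert-self {v} {x} ∣x∣ s zero w _ with ∣ x ∣ ℕ.≟ suc v
... | yes _ = cong (sgnMul x ∘ suc) (sym (ℕ.+-identityʳ s))
... | no ≢  = contradiction ∣x∣ ≢
invAt-insert-self {v} {x} ∣x∣ s (suc p) (y ∷ w) (s≤s p≤) with ∣ up v y ∣ ℕ.≟ suc v
... | yes eq = contradiction eq (∣up∣≢ v y)
... | no _   = ≡.trans (invAt-insert-self ∣x∣ (suc s) p w p≤) (cong (sgnMul x ∘ suc) (sym (ℕ.+-suc s p)))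

applyUpTo-cong : {A : Set} {f g : ℕ → A} → (∀ k → f k ≡ g k) → ∀ n → applyUpTo f n ≡ applyUpTo g n
applyUpTo-cong f≗g n = ≡.trans (sym (map-upTo _ n)) (≡.trans (map-cong f≗g (upTo n)) (map-upTo _ n))

-- `upℕ v` runs through all indices except `v`, so the hypothesis determines every entry other than
-- the inserted `f v`.
applyUpTo-insert : {A B : Set} (f : ℕ → B) (g : ℕ → A) (h : A → B) {v m : ℕ} → v ≤ m →
  (∀ k → f (upℕ v k) ≡ h (g k)) → applyUpTo f (suc m) ≡ insert v (f v) (map h (applyUpTo g m))
applyUpTo-insert f g h {m = m} z≤n eq = cong (f 0 ∷_) (begin
  applyUpTo (f ∘ suc) m ≡⟨ applyUpTo-cong eq m ⟩
  applyUpTo (h ∘ g) m   ≡⟨ map-upTo (h ∘ g) m ⟨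
  map (h ∘ g) (upTo m)  ≡⟨ map-∘ (upTo m) ⟩
  map h (map g (upTo m)) ≡⟨ cong (map h) (map-upTo g m) ⟩
  map h (applyUpTo g m) ∎)
applyUpTo-insert f g h (s≤s v≤m) eq =
  cong₂ _∷_ (eq 0) (applyUpTo-insert (f ∘ suc) (g ∘ suc) h v≤m (eq ∘ suc))

insert-↭ : {A : Set} (p : ℕ) (x : A) (w : List A) → insert p x w ↭ x ∷ w
insert-↭ zero    x w       = refl
insert-↭ (suc p) x []      = refl
insert-↭ (suc p) x (y ∷ w) = trans (prep y (insert-↭ p x w)) (swap y x refl)

ins : ℕ → ℤ → List ℤ → List ℤ
ins p x w = insert p x (map (up (ℕ.pred ∣ x ∣)) w)

-- Place and value change roles, so `desFrom-insert` also governs `idesB`.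
inverseB-insert : ∀ {v x} → ∣ x ∣ ≡ suc v → ∀ p w → v ≤ length w → p ≤ length w →
  inverseB (insert p x (map (up v) w)) ≡ insert v (sgnMul x (suc p)) (map (up p) (inverseB w))
inverseB-insert {v} {x} ∣x∣ p w v≤ p≤ = begin
  applyUpTo (λ k → invAt (suc k) 1 (insert p x (map (up v) w))) (length (insert p x (map (up v) w)))
    ≡⟨ cong (applyUpTo _) (≡.trans (↭-length (insert-↭ p x _)) (cong suc (length-map _ w))) ⟩
  applyUpTo (λ k → invAt (suc k) 1 (insert p x (map (up v) w))) (suc (length w))
    ≡⟨ applyUpTo-insert f _ (up p) v≤ (λ k → invAt-insert-other {x = x} ∣x∣ k 0 p w) ⟩
  insert v (invAt (suc v) 1 (insert p x (map (up v) w))) (map (up p) (inverseB w))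
    ≡⟨ cong (λ y → insert v y (map (up p) (inverseB w))) (invAt-insert-self ∣x∣ 0 p w p≤) ⟩
  insert v (sgnMul x (suc p)) (map (up p) (inverseB w)) ∎
  where
  f : ℕ → ℤ
  f k = invAt (suc k) 1 (insert p x (map (up v) w))

-- Signed permutations

data Letter (n : ℕ) : ℤ → Set where
  pos : ∀ {k} → k ℕ.< n → Letter n (+ suc k)
  neg : ∀ {k} → k ℕ.< n → Letter n -[1+ k ]

∈-letters⁺ : ∀ {n x} → Letter n x → x ∈ letters n
∈-letters⁺     (pos k<n) = ∈-++⁺ˡ (∈-applyUpTo⁺ _ k<n)
∈-letters⁺ {n} (neg k<n) = ∈-++⁺ʳ (applyUpTo _ n) (∈-applyUpTo⁺ _ k<n)

∈-letters⁻ : ∀ {n x} → x ∈ letters n → Letter n x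
∈-letters⁻ {n} x∈ with ∈-++⁻ (applyUpTo _ n) x∈
... | inj₁ x∈⁺ with ∈-applyUpTo⁻ _ x∈⁺
...   | k , k<n , refl = pos k<n
∈-letters⁻ {n} x∈ | inj₂ x∈⁻ with ∈-applyUpTo⁻ _ x∈⁻
...   | k , k<n , refl = neg k<n

record SignedPerm (n : ℕ) (w : List ℤ) : Set where
  constructor signedPerm
  field
    length≡ : length w ≡ n
    letter  : All (Letter n) w
    unique  : Unique (map ∣_∣ w)

-- Brings `words` into the form to which membership and uniqueness for Cartesian products apply.
words-suc : ∀ n m → words n (suc m) ≡ cartesianProductWith _∷_ (letters n) (words n m)
words-suc n m = go (letters n)
  where
  go : ∀ as → concatMap (λ a → map (a ∷_) (words n m)) as ≡ cartesianProductWith _∷_ as (words n m)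
  go []       = refl
  go (a ∷ as) = cong (map (a ∷_) (words n m) ++_) (go as)

∈-words⁺ : ∀ {n w} → All (Letter n) w → w ∈ words n (length w)
∈-words⁺ []       = here refl
∈-words⁺ {n} {x ∷ w} (l ∷ ls) =
  subst (_ ∈_) (sym (words-suc n (length w))) (∈-cartesianProductWith⁺ _∷_ (∈-letters⁺ l) (∈-words⁺ ls))

∈-words⁻ : ∀ n m {w} → w ∈ words n m → length w ≡ m × All (Letter n) w
∈-words⁻ n zero    (here refl) = refl , []
∈-words⁻ n (suc m) w∈ with ∈-cartesianProductWith⁻ _∷_ (letters n) (words n m) (subst (_ ∈_) (words-suc n m) w∈)
... | x , u , x∈ , u∈ , refl with ∈-words⁻ n m u∈
...   | len , ls = cong suc len , ∈-letters⁻ x∈ ∷ ls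

∈-signedPerms⁺ : ∀ {n w} → SignedPerm n w → w ∈ signedPerms n
∈-signedPerms⁺ (signedPerm refl ls u) = ∈-filter⁺ distinctAbs? (∈-words⁺ ls) u

∈-signedPerms⁻ : ∀ {n w} → w ∈ signedPerms n → SignedPerm n w
∈-signedPerms⁻ {n} w∈ with ∈-filter⁻ distinctAbs? w∈
... | w∈words , u with ∈-words⁻ n n w∈words
...   | len , ls = signedPerm len ls u

letters-unique : ∀ n → Unique (letters n)
letters-unique n = Unique.++⁺
  (Unique.applyUpTo⁺₁ _ n (λ i<j _ → λ { refl → ℕ.<-irrefl refl i<j }))
  (Unique.applyUpTo⁺₁ _ n (λ i<j _ → λ { refl → ℕ.<-irrefl refl i<j }))
  (λ { (x∈⁺ , x∈⁻) → disjoint (∈-applyUpTo⁻ _ x∈⁺) (∈-applyUpTo⁻ _ x∈⁻) })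
  where
  disjoint : ∀ {x} → ∃ (λ k → k ℕ.< n × x ≡ + suc k) → ¬ ∃ (λ k → k ℕ.< n × x ≡ -[1+ k ])
  disjoint (_ , _ , refl) (_ , _ , ())

words-unique : ∀ n m → Unique (words n m)
words-unique n zero    = [] ∷ []
words-unique n (suc m) = subst Unique (sym (words-suc n m))
  (Unique.cartesianProductWith⁺ _∷_ (λ { refl → refl , refl }) (letters-unique n) (words-unique n m))

signedPerms-unique : ∀ n → Unique (signedPerms n)
signedPerms-unique n = Unique.filter⁺ distinctAbs? (words-unique n n)

SignedPerm-resp-↭ : ∀ {n u w} → u ↭ w → SignedPerm n u → SignedPerm n w
SignedPerm-resp-↭ u↭w (signedPerm len ls uniq) = signedPerm
  (≡.trans (sym (↭-length u↭w)) len)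
  (All-resp-↭ u↭w ls)
  (Permutationₛ.Unique-resp-↭ (setoid ℕ) (↭⇒↭ₛ (map⁺ ∣_∣ u↭w)) uniq)

upℕ≤suc : ∀ v k → upℕ v k ≤ suc k
upℕ≤suc zero    k       = ℕ.≤-refl
upℕ≤suc (suc v) zero    = z≤n
upℕ≤suc (suc v) (suc k) = s≤s (upℕ≤suc v k)

upℕ-bound⁻ : ∀ {v j m} → v ≤ m → upℕ v j ≤ m → j ℕ.< m
upℕ-bound⁻ {v} {j} v≤m up≤m with j ℕ.<? v
... | yes j<v = ℕ.<-≤-trans j<v v≤m
... | no  j≮v = subst (_≤ _) (upℕ-≥ (ℕ.≮⇒≥ j≮v)) up≤m

up-letter : ∀ v {m x} → Letter m x → Letter (suc m) (up v x)
up-letter v (pos k<m) = pos (s≤s (ℕ.≤-trans (upℕ≤suc v _) k<m))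
up-letter v (neg k<m) = neg (s≤s (ℕ.≤-trans (upℕ≤suc v _) k<m))

up-surjective : ∀ {v m y} → v ≤ m → Letter (suc m) y → ∣ y ∣ ≢ suc v → ∃ λ x → up v x ≡ y × Letter m x
up-surjective {v} v≤m (pos {k} (s≤s k≤m)) ≢ with upℕ-surjective v k (≢ ∘ cong suc)
... | j , refl = + suc j , refl , pos (upℕ-bound⁻ v≤m k≤m)
up-surjective {v} v≤m (neg {k} (s≤s k≤m)) ≢ with upℕ-surjective v k (≢ ∘ cong suc)
... | j , refl = -[1+ j ] , refl , neg (upℕ-bound⁻ v≤m k≤m)

map-up-surjective : ∀ {v m w} → v ≤ m → All (Letter (suc m)) w → All (suc v ≢_) (map ∣_∣ w) →
  ∃ λ u → map (up v) u ≡ w × All (Letter m) u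
map-up-surjective {w = []}    v≤m []       []       = [] , refl , []
map-up-surjective {w = y ∷ w} v≤m (l ∷ ls) (≢ ∷ ≢s)
  with up-surjective v≤m l (≢ ∘ sym) | map-up-surjective v≤m ls ≢s
... | x , refl , l′ | u , refl , ls′ = x ∷ u , refl , l′ ∷ ls′

map-∣∣-map-up : ∀ v w → map ∣_∣ (map (up v) w) ≡ map (upℕ (suc v)) (map ∣_∣ w)
map-∣∣-map-up v w = begin
  map ∣_∣ (map (up v) w)          ≡⟨ map-∘ w ⟨
  map (∣_∣ ∘ up v) w              ≡⟨ map-cong (∣up∣ v) w ⟩
  map (upℕ (suc v) ∘ ∣_∣) w       ≡⟨ map-∘ w ⟩
  map (upℕ (suc v)) (map ∣_∣ w) ∎

letter-∣∣ : ∀ {n x} → Letter n x → ∣ x ∣ ≡ suc (ℕ.pred ∣ x ∣) × ℕ.pred ∣ x ∣ ℕ.< n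
letter-∣∣ (pos k<n) = refl , k<n
letter-∣∣ (neg k<n) = refl , k<n

SignedPerm-∷⁺ : ∀ {m x u} → Letter (suc m) x → SignedPerm m u → SignedPerm (suc m) (x ∷ map (up (ℕ.pred ∣ x ∣)) u)
SignedPerm-∷⁺ {m} {x} {u} l (signedPerm len ls uniq) with letter-∣∣ l
... | ∣x∣ , _ = signedPerm
  (cong suc (≡.trans (length-map _ u) len))
  (l ∷ All.map⁺ (All.map (up-letter _) ls))
  (All.map⁺ (All.map⁺ (All.map (λ {y} _ eq → ∣up∣≢ _ y (≡.trans (sym eq) ∣x∣)) ls))
    ∷ subst Unique (sym (map-∣∣-map-up _ u)) (Unique.map⁺ (upℕ-injective _) uniq))

-- The other letters avoid `∣ x ∣`, so each has a preimage under the renumbering, and distinct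
-- images have distinct preimages.
SignedPerm-∷⁻ : ∀ {m x w} → SignedPerm (suc m) (x ∷ w) →
  Letter (suc m) x × ∃ λ u → map (up (ℕ.pred ∣ x ∣)) u ≡ w × SignedPerm m u
SignedPerm-∷⁻ (signedPerm len (l ∷ ls) (≢s ∷ uniq)) with letter-∣∣ l
... | ∣x∣ , s≤s v≤m with map-up-surjective v≤m ls (subst (λ k → All (k ≢_) _) ∣x∣ ≢s)
...   | u , refl , ls′ = l , u , refl , signedPerm
        (≡.trans (sym (length-map _ u)) (ℕ.suc-injective len))
        ls′
        (Unique.map⁻ (subst Unique (map-∣∣-map-up _ u) uniq))

insert≢[] : {A : Set} → ∀ p {x : A} {u} → insert p x u ≢ []
insert≢[] zero            ()
insert≢[] (suc p) {u = []}    ()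
insert≢[] (suc p) {u = _ ∷ _} ()

insert-injective : {A : Set} → ∀ p {x y : A} {u w} → insert p x u ≡ insert p y w → x ≡ y × u ≡ w
insert-injective zero                        refl = refl , refl
insert-injective (suc p) {u = []}    {[]}    refl = refl , refl
insert-injective (suc p) {u = []}    {_ ∷ w} eq   = contradiction (sym (∷-injectiveʳ eq)) (insert≢[] p)
insert-injective (suc p) {u = _ ∷ u} {[]}    eq   = contradiction (∷-injectiveʳ eq) (insert≢[] p)
insert-injective (suc p) {u = z ∷ u} {z′ ∷ w} eq with ∷-injective eq
... | refl , eq′ with insert-injective p eq′
...   | refl , refl = refl , refl

insert-surjective : {A : Set} → ∀ p (w : List A) → p ℕ.< length w → ∃₂ λ x u → insert p x u ≡ w
insert-surjective zero    (x ∷ w) _         = x , w , refl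
insert-surjective (suc p) (y ∷ w) (s≤s p<) with insert-surjective p w p<
... | x , u , refl = x , y ∷ u , refl

ins-injective : ∀ p {x y u w} → ins p x u ≡ ins p y w → x ≡ y × u ≡ w
ins-injective p eq with insert-injective p eq
... | refl , eq′ = refl , map-injective (up-injective _) eq′

-- Duplicate-free lists with the same members are permutations of each other. Both inclusions move
-- the letter at place `p` to the front, where it can be removed or added.
signedPerms-suc-↭ : ∀ {p m} → p ≤ m →
  signedPerms (suc m) ↭ cartesianProductWith (ins p) (letters (suc m)) (signedPerms m)
signedPerms-suc-↭ {p} {m} p≤m = ∼bag⇒↭ (unique∧set⇒bag
  (signedPerms-unique (suc m))
  (Unique.cartesianProductWith⁺ (ins p) (ins-injective p) (letters-unique (suc m)) (signedPerms-unique m))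
  (mk⇔ to from))
  where
  to : ∀ {w} → w ∈ signedPerms (suc m) → w ∈ cartesianProductWith (ins p) (letters (suc m)) (signedPerms m)
  to {w} w∈ with ∈-signedPerms⁻ w∈
  ... | sp with insert-surjective p w (subst (p ℕ.<_) (sym (SignedPerm.length≡ sp)) (s≤s p≤m))
  ...   | x , _ , refl with SignedPerm-∷⁻ (SignedPerm-resp-↭ (insert-↭ p x _) sp)
  ...     | l , u , refl , spu = ∈-cartesianProductWith⁺ (ins p) (∈-letters⁺ l) (∈-signedPerms⁺ spu)
  from : ∀ {w} → w ∈ cartesianProductWith (ins p) (letters (suc m)) (signedPerms m) → w ∈ signedPerms (suc m)
  from w∈ with ∈-cartesianProductWith⁻ (ins p) (letters (suc m)) (signedPerms m) w∈
  ... | x , u , x∈ , u∈ , refl = ∈-signedPerms⁺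
    (SignedPerm-resp-↭ (↭-sym (insert-↭ p x _)) (SignedPerm-∷⁺ (∈-letters⁻ x∈) (∈-signedPerms⁻ u∈)))

-- Every absolute value occurs, by induction instead of a pigeonhole count: either the first letter
-- carries `k + 1`, or `k` is the renumbering of some `j`, found in the shorter permutation left by
-- deleting that letter.
invAt-nonzero : ∀ {m w} → SignedPerm m w → ∀ {k} s → k ℕ.< m → invAt (suc k) (suc s) w ≢ + 0
invAt-nonzero {suc m} {[]} (signedPerm () _ _)
invAt-nonzero {suc m} {x ∷ w} sp {k} s (s≤s k≤m) eq with SignedPerm-∷⁻ sp
... | l , u , refl , spu with letter-∣∣ l
...   | ∣x∣ , s≤s v≤m with k ℕ.≟ ℕ.pred ∣ x ∣
...     | yes refl = sgnMul≢0 x (≡.trans (sym (invAt-insert-self {x = x} ∣x∣ s 0 u z≤n)) eq)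
  where
  sgnMul≢0 : ∀ y {i} → sgnMul y (suc i) ≢ + 0
  sgnMul≢0 (+ _) ()
  sgnMul≢0 -[1+ _ ] ()
...     | no k≢v with upℕ-surjective (ℕ.pred ∣ x ∣) k k≢v
...       | j , refl = invAt-nonzero spu s (upℕ-bound⁻ v≤m k≤m)
                         (up-injective _ (≡.trans (sym (invAt-insert-other {x = x} ∣x∣ j s 0 u)) eq))

at-All : ∀ {R : ℤ → Set} {∞ a w} → R a → All R w → ∀ {p} → p ≤ length w → R (at ∞ a w p)
at-All ra rw        {zero}  _         = ra
at-All ra (rb ∷ rw) {suc p} (s≤s p≤) = at-All rb rw p≤

at-All-suc : ∀ {R : ℤ → Set} {∞ a w} → All R w → ∀ {p} → p ℕ.< length w → R (at ∞ a w (suc p))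
at-All-suc (rb ∷ rw) (s≤s p≤) = at-All rb rw p≤

at-applyUpTo : ∀ {∞ a} (f : ℕ → ℤ) {m k} → k ℕ.< m → at ∞ a (applyUpTo f m) (suc k) ≡ f k
at-applyUpTo f {suc m} {zero}  _         = refl
at-applyUpTo f {suc m} {suc k} (s≤s k<m) = at-applyUpTo (f ∘ suc) k<m

-- The search stops at the first letter with the right absolute value, and distinctness rules out an
-- earlier one.
invAt-at : ∀ {∞ a w} s → Unique (map ∣_∣ w) → ∀ {p} → p ℕ.< length w →
  invAt ∣ at ∞ a w (suc p) ∣ s w ≡ sgnMul (at ∞ a w (suc p)) (s ℕ.+ p)
invAt-at {w = y ∷ w} s _ {zero} _ with ∣ y ∣ ℕ.≟ ∣ y ∣
... | yes _ = cong (sgnMul y) (sym (ℕ.+-identityʳ s))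
... | no ≢  = contradiction refl ≢
invAt-at {∞} {w = y ∷ w} s (≢s ∷ uniq) {suc p} (s≤s p<) with ∣ y ∣ ℕ.≟ ∣ at ∞ y w (suc p) ∣
... | yes eq = contradiction eq (at-All-suc {R = λ z → ∣ y ∣ ≢ ∣ z ∣} (All.map⁻ ≢s) p<)
... | no _   = ≡.trans (invAt-at (suc s) uniq p<) (cong (sgnMul (at ∞ y w (suc p))) (sym (ℕ.+-suc s p)))

invAt-hit : ∀ ∞ a k s w → invAt (suc k) (suc s) w ≡ + 0 ⊎
  ∃ λ j → j ℕ.< length w × ∣ at ∞ a w (suc j) ∣ ≡ suc k ×
          invAt (suc k) (suc s) w ≡ sgnMul (at ∞ a w (suc j)) (suc (s ℕ.+ j))
invAt-hit ∞ a k s [] = inj₁ refl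
invAt-hit ∞ a k s (y ∷ w) with ∣ y ∣ ℕ.≟ suc k
... | yes eq = inj₂ (0 , s≤s z≤n , eq , cong (sgnMul y ∘ suc) (sym (ℕ.+-identityʳ s)))
... | no _ with invAt-hit ∞ y k (suc s) w
...   | inj₁ eq = inj₁ eq
...   | inj₂ (j , j< , ∣y∣ , eq) =
        inj₂ (suc j , s≤s j< , ∣y∣ , ≡.trans eq (cong (sgnMul (at ∞ y w (suc j)) ∘ suc) (sym (ℕ.+-suc s j))))

∣sgnMul∣ : ∀ y i → ∣ sgnMul y i ∣ ≡ i
∣sgnMul∣ (+ _)    i = refl
∣sgnMul∣ -[1+ _ ] i = ℤ.∣-i∣≡∣i∣ (+ i)

sgnMul-sgnMul : ∀ y {i k} → ∣ y ∣ ≡ suc k → sgnMul (sgnMul y (suc i)) (suc k) ≡ y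
sgnMul-sgnMul (+ _)    refl = refl
sgnMul-sgnMul -[1+ _ ] refl = refl

∣invAt∣≤ : ∀ k w → ∣ invAt (suc k) 1 w ∣ ≤ length w
∣invAt∣≤ k w with invAt-hit (+ 0) (+ 0) k 0 w
... | inj₁ eq = subst (λ z → ∣ z ∣ ≤ length w) (sym eq) z≤n
... | inj₂ (j , j< , _ , eq) = subst (_≤ length w) (sym (≡.trans (cong ∣_∣ eq) (∣sgnMul∣ (at (+ 0) (+ 0) w (suc j)) (suc j)))) j<

length-inverseB : ∀ w → length (inverseB w) ≡ length w
length-inverseB w = length-applyUpTo _ (length w)

-- One signed permutation, its inverse and its insertions

module Insertion (w : List ℤ) (sp : SignedPerm (length w) w) where

  m n : ℕ
  m = length w
  n = suc m

  -- Reading n + 1 just past the end of w makes insertion at the end an instance of the general case.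
  ∞ : ℤ
  ∞ = + suc n

  P Q : ℕ → ℤ
  P = at ∞ (+ 0) w
  Q = at ∞ (+ 0) (inverseB w)

  small-w : All (λ x → ∣ x ∣ ℕ.< n) w
  small-w = All.map (λ l → s≤s (subst (_≤ m) (sym (proj₁ (letter-∣∣ l))) (proj₂ (letter-∣∣ l)))) (SignedPerm.letter sp)

  small-inverse : All (λ x → ∣ x ∣ ℕ.< n) (inverseB w)
  small-inverse = All.applyUpTo⁺₂ _ m (λ k → s≤s (∣invAt∣≤ k w))

  boundary : ∀ {u} → length u ≡ m → All (λ x → ∣ x ∣ ℕ.< n) u → Boundary n (at ∞ (+ 0) u)
  boundary {u} len small = record
    { start = refl
    ; end   = subst (λ l → at ∞ (+ 0) u (suc l) ≡ ∞) len (at-length ∞ (+ 0) u)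
    ; small = λ { p (s≤s p≤m) → at-All {R = λ x → ∣ x ∣ ℕ.< n} (s≤s z≤n) small (subst (p ≤_) (sym len) p≤m) }
    }

  below-∞ : ∀ {u} → All (λ x → ∣ x ∣ ℕ.< n) u → All (ℤ._≤ ∞) (+ 0 ∷ u)
  below-∞ small = ℤ.+≤+ z≤n ∷ All.map (λ { {+ k} k<n → ℤ.+≤+ (ℕ.≤-trans (ℕ.<⇒≤ k<n) (ℕ.n≤1+n n)) ; { -[1+ _ ]} _ → ℤ.-≤+ }) small

  boundary-P : Boundary n P
  boundary-P = boundary refl small-w

  boundary-Q : Boundary n Q
  boundary-Q = boundary (length-inverseB w) small-inverse

  Q-suc : ∀ {v} → v ℕ.< m → Q (suc v) ≡ invAt (suc v) 1 w
  Q-suc = at-applyUpTo (λ k → invAt (suc k) 1 w)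

  end-large : ∀ {u p} → Boundary n u → ¬ p ℕ.< m → suc p ≤ n → ¬ ∣ u (suc p) ∣ ≤ n
  end-large {u} {p} b p≮m (s≤s p≤m) ≤n with ℕ.≤-antisym p≤m (ℕ.≮⇒≥ p≮m)
  ... | refl = ℕ.<-irrefl refl (subst (λ z → ∣ z ∣ ≤ n) (Boundary.end b) ≤n)

  inverse-PQ : Inverse n P Q
  inverse-PQ zero    _   _ = refl
  inverse-PQ (suc p) p<n P≤ with p ℕ.<? m
  ... | no  p≮m = contradiction P≤ (end-large boundary-P p≮m p<n)
  ... | yes p<m with letter-∣∣ (at-All-suc {∞ = ∞} {+ 0} (SignedPerm.letter sp) p<m)
  ...   | ∣y∣ , v<m = begin
    Q ∣ P (suc p) ∣                        ≡⟨ cong Q ∣y∣ ⟩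
    Q (suc (ℕ.pred ∣ P (suc p) ∣))         ≡⟨ Q-suc v<m ⟩
    invAt (suc (ℕ.pred ∣ P (suc p) ∣)) 1 w ≡⟨ cong (λ k → invAt k 1 w) ∣y∣ ⟨
    invAt ∣ P (suc p) ∣ 1 w                ≡⟨ invAt-at 1 (SignedPerm.unique sp) p<m ⟩
    sgnMul (P (suc p)) (suc p)             ∎

  -- The place `j` of `±(v + 1)` is recovered from the search defining `Q`, whose default 0 is
  -- excluded by `invAt-nonzero`; `sgnMul` then carries the sign to the place and back.
  inverse-QP : Inverse n Q P
  inverse-QP zero    _   _ = refl
  inverse-QP (suc v) v<n Q≤ with v ℕ.<? m
  ... | no  v≮m = contradiction Q≤ (end-large boundary-Q v≮m v<n)
  ... | yes v<m with invAt-hit ∞ (+ 0) v 0 w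
  ...   | inj₁ eq = contradiction eq (invAt-nonzero sp 0 v<m)
  ...   | inj₂ (j , j<m , ∣y∣ , eq) = begin
    P ∣ Q (suc v) ∣                               ≡⟨ cong (P ∘ ∣_∣) Qv ⟩
    P ∣ sgnMul (P (suc j)) (suc j) ∣              ≡⟨ cong P (∣sgnMul∣ (P (suc j)) (suc j)) ⟩
    P (suc j)                                     ≡⟨ sgnMul-sgnMul (P (suc j)) ∣y∣ ⟨
    sgnMul (sgnMul (P (suc j)) (suc j)) (suc v)   ≡⟨ cong (λ z → sgnMul z (suc v)) Qv ⟨
    sgnMul (Q (suc v)) (suc v)                    ∎
    where
    Qv : Q (suc v) ≡ sgnMul (P (suc j)) (suc j)
    Qv = ≡.trans (Q-suc v<m) eq

  open Joint boundary-P boundary-Q inverse-PQ inverse-QP public using (∑-D; ∑-D*D)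

  descents-P : descents n P ≡ + desB w
  descents-P = ∑-lt-at ∞ (+ 0) w (below-∞ small-w)

  descents-Q : descents n Q ≡ + idesB w
  descents-Q = subst (λ k → descents (suc k) Q ≡ + idesB w) (length-inverseB w)
                     (∑-lt-at ∞ (+ 0) (inverseB w) (below-∞ small-inverse))

  keeps-D⁺ : ∀ v (R : ℕ → ℤ) p → keeps v (+ suc v) (R p) (R (suc p)) ≡ D⁺ R p v
  keeps-D⁺ v R p = cong (_+_ (lt (R (suc p)) (R p))) (cong₂ _-_ (lt-up-pos v (R p)) (lt-up-pos v (R (suc p))))

  keeps-D⁻ : ∀ v (R : ℕ → ℤ) p → keeps v -[1+ v ] (R p) (R (suc p)) ≡ D⁻ R p v
  keeps-D⁻ v R p = cong (_+_ (lt (R (suc p)) (R p))) (cong₂ _-_ (lt-up-neg v (R p)) (lt-up-neg v (R (suc p))))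

  pos<up-∞ : ∀ {v} → v ≤ m → + suc v ℤ.< up v ∞
  pos<up-∞ v≤m = +<+ (s≤s (upℕ-≥⁺ (ℕ.m≤n⇒m≤1+n v≤m)))

  module _ {p v : ℕ} (p≤m : p ≤ m) (v≤m : v ≤ m) where

    desB-ins⁺ : + desB (ins p (+ suc v) w) ≡ + desB w + + 1 - D⁺ P p v
    desB-ins⁺ = ≡.trans (desFrom-insert ∞ refl (pos<up-∞ v≤m) p (+ 0) w (below-∞ small-w) p≤m)
                        (cong (λ d → + desB w + + 1 - d) (keeps-D⁺ v P p))

    desB-ins⁻ : + desB (ins p -[1+ v ] w) ≡ + desB w + + 1 - D⁻ P p v
    desB-ins⁻ = ≡.trans (desFrom-insert ∞ refl -<+ p (+ 0) w (below-∞ small-w) p≤m)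
                        (cong (λ d → + desB w + + 1 - d) (keeps-D⁻ v P p))

    private
      v≤length : v ≤ length (inverseB w)
      v≤length = subst (v ≤_) (sym (length-inverseB w)) v≤m

    idesB-ins⁺ : + idesB (ins p (+ suc v) w) ≡ + idesB w + + 1 - D⁺ Q v p
    idesB-ins⁺ = begin
      + idesB (ins p (+ suc v) w)
        ≡⟨ cong (+_ ∘ desB) (inverseB-insert refl p w v≤m p≤m) ⟩
      + desB (insert v (+ suc p) (map (up p) (inverseB w)))
        ≡⟨ desFrom-insert ∞ refl (pos<up-∞ p≤m) v (+ 0) (inverseB w) (below-∞ small-inverse) v≤length ⟩
      + idesB w + + 1 - keeps p (+ suc p) (Q v) (Q (suc v))
        ≡⟨ cong (λ d → + idesB w + + 1 - d) (keeps-D⁺ p Q v) ⟩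
      + idesB w + + 1 - D⁺ Q v p ∎

    idesB-ins⁻ : + idesB (ins p -[1+ v ] w) ≡ + idesB w + + 1 - D⁻ Q v p
    idesB-ins⁻ = begin
      + idesB (ins p -[1+ v ] w)
        ≡⟨ cong (+_ ∘ desB) (inverseB-insert refl p w v≤m p≤m) ⟩
      + desB (insert v -[1+ p ] (map (up p) (inverseB w)))
        ≡⟨ desFrom-insert ∞ refl -<+ v (+ 0) (inverseB w) (below-∞ small-inverse) v≤length ⟩
      + idesB w + + 1 - keeps p -[1+ p ] (Q v) (Q (suc v))
        ≡⟨ cong (λ d → + idesB w + + 1 - d) (keeps-D⁻ p Q v) ⟩
      + idesB w + + 1 - D⁻ Q v p ∎

-- The recurrence

-- Integer indices admit -1, where this vanishes just as `b̄` does, so the shifts by one need no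
-- case distinction.
statistic : ℤ → ℤ → List ℤ → ℤ
statistic i j w = eq (+ desB w) i * eq (+ idesB w) j

length-filter : {A : Set} {R : A → Set} (R? : ∀ x → Dec (R x)) (xs : List A) →
  + length (filter R? xs) ≡ ∑[ x ← xs ] ⟦ R? x ⟧
length-filter R? []       = refl
length-filter R? (x ∷ xs) with R? x
... | yes _ = cong (_+_ (+ 1)) (length-filter R? xs)
... | no  _ = ≡.trans (length-filter R? xs) (sym (ℤ.+-identityˡ _))

⟦⟧-×-dec : (a? : Dec X) (b? : Dec Y) → ⟦ a? ×-dec b? ⟧ ≡ ⟦ a? ⟧ * ⟦ b? ⟧
⟦⟧-×-dec (yes _) (yes _) = refl
⟦⟧-×-dec (yes _) (no _)  = refl
⟦⟧-×-dec (no _)  (yes _) = refl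
⟦⟧-×-dec (no _)  (no _)  = refl

b̄-sum : ∀ n i j → b̄ n i j ≡ ∑ (signedPerms n) (statistic i j)
b̄-sum n (+ i) (+ j) = ≡.trans (length-filter _ (signedPerms n)) (∑-ext (signedPerms n) λ w →
  ≡.trans (⟦⟧-×-dec (desB w ℕ.≟ i) (idesB w ℕ.≟ j))
          (cong₂ _*_ (⟦⟧-cong (λ d≡ → cong +_ d≡) ℤ.+-injective (desB w ℕ.≟ i) (+ desB w ≟ + i))
                     (⟦⟧-cong (λ d≡ → cong +_ d≡) ℤ.+-injective (idesB w ℕ.≟ j) (+ idesB w ≟ + j))))
b̄-sum n (+ i) -[1+ j ] = sym (≡.trans (∑-ext (signedPerms n) (λ w → ℤ.*-zeroʳ (eq (+ desB w) (+ i)))) (∑-0 (signedPerms n)))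
b̄-sum n -[1+ i ] (+ j)    = sym (∑-0 (signedPerms n))
b̄-sum n -[1+ i ] -[1+ j ] = sym (∑-0 (signedPerms n))

∑-letters : ∀ n (f : ℤ → ℤ) → ∑ (letters n) f ≡ ∑[ v ← upTo n ] (f (+ suc v) + f -[1+ v ])
∑-letters n f = begin
  ∑ (letters n) f
    ≡⟨ ∑-++ (applyUpTo (λ k → + suc k) n) _ f ⟩
  ∑ (applyUpTo (λ k → + suc k) n) f + ∑ (applyUpTo -[1+_] n) f
    ≡⟨ cong₂ _+_ (∑-applyUpTo n (λ k → + suc k) f) (∑-applyUpTo n -[1+_] f) ⟩
  (∑[ v ← upTo n ] f (+ suc v)) + (∑[ v ← upTo n ] f -[1+ v ])
    ≡⟨ ∑-+ (upTo n) _ _ ⟨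
  ∑[ v ← upTo n ] (f (+ suc v) + f -[1+ v ]) ∎

-- For each position p, deleting the p-th letter is a bijection, so averaging over p is harmless.
∑-signedPerms-suc : ∀ m (f : List ℤ → ℤ) → + suc m * ∑ (signedPerms (suc m)) f ≡
  ∑[ w ← signedPerms m ] ∑[ p ← upTo (suc m) ] ∑[ v ← upTo (suc m) ] (f (ins p (+ suc v) w) + f (ins p -[1+ v ] w))
∑-signedPerms-suc m f = begin
  + suc m * ∑ (signedPerms (suc m)) f
    ≡⟨ cong (λ k → + k * ∑ (signedPerms (suc m)) f) (length-upTo (suc m)) ⟨
  + length (upTo (suc m)) * ∑ (signedPerms (suc m)) f
    ≡⟨ ∑-const (upTo (suc m)) _ ⟨
  ∑[ p ← upTo (suc m) ] ∑ (signedPerms (suc m)) f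
    ≡⟨ ∑-cong (upTo (suc m)) (λ p∈ → delete (ℕ.s≤s⁻¹ (∈-upTo⁻ p∈))) ⟩
  ∑[ p ← upTo (suc m) ] ∑[ w ← signedPerms m ] ∑[ v ← upTo (suc m) ] (f (ins p (+ suc v) w) + f (ins p -[1+ v ] w))
    ≡⟨ ∑-swap (upTo (suc m)) (signedPerms m) _ ⟩
  ∑[ w ← signedPerms m ] ∑[ p ← upTo (suc m) ] ∑[ v ← upTo (suc m) ] (f (ins p (+ suc v) w) + f (ins p -[1+ v ] w)) ∎
  where
  delete : ∀ {p} → p ≤ m → ∑ (signedPerms (suc m)) f ≡
    ∑[ w ← signedPerms m ] ∑[ v ← upTo (suc m) ] (f (ins p (+ suc v) w) + f (ins p -[1+ v ] w))
  delete {p} p≤m = begin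
    ∑ (signedPerms (suc m)) f
      ≡⟨ ∑-↭ f (signedPerms-suc-↭ p≤m) ⟩
    ∑ (cartesianProductWith (ins p) (letters (suc m)) (signedPerms m)) f
      ≡⟨ ∑-cartesianProductWith (ins p) (letters (suc m)) (signedPerms m) f ⟩
    ∑[ x ← letters (suc m) ] ∑[ w ← signedPerms m ] f (ins p x w)
      ≡⟨ ∑-swap (letters (suc m)) (signedPerms m) _ ⟩
    ∑[ w ← signedPerms m ] ∑[ x ← letters (suc m) ] f (ins p x w)
      ≡⟨ ∑-ext (signedPerms m) (λ w → ∑-letters (suc m) (λ x → f (ins p x w))) ⟩
    ∑[ w ← signedPerms m ] ∑[ v ← upTo (suc m) ] (f (ins p (+ suc v) w) + f (ins p -[1+ v ] w)) ∎

-- `D` selects whether `i` is reached from `i` or from `i − 1`. The right side is linear in `D` and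
-- can therefore be summed.
eq-step : ∀ {d′} d D i → + d′ ≡ + d + + 1 - D → D ≡ + 0 ⊎ D ≡ + 1 →
  eq (+ d′) i ≡ D * eq (+ d) i + (+ 1 - D) * eq (+ d) (i - + 1)
eq-step {d′} d D i step (inj₁ refl) = begin
  eq (+ d′) i               ≡⟨ eq-cong (λ d′≡i → ≡.trans (sym (≡.trans (cong (_- + 1) step) (cancel (+ d)))) (cong (_- + 1) d′≡i))
                                       (λ d≡i-1 → ≡.trans step (≡.trans (cong (λ z → z + + 1 - + 0) d≡i-1) (cancel′ i))) ⟩
  eq (+ d) (i - + 1)        ≡⟨ simplify (eq (+ d) i) _ ⟨
  + 0 * eq (+ d) i + (+ 1 - + 0) * eq (+ d) (i - + 1) ∎
  where
  cancel : ∀ x → x + + 1 - + 0 - + 1 ≡ x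
  cancel = solve-∀
  cancel′ : ∀ x → x - + 1 + + 1 - + 0 ≡ x
  cancel′ = solve-∀
  simplify : ∀ a b → + 0 * a + (+ 1 - + 0) * b ≡ b
  simplify = solve-∀
eq-step {d′} d D i step (inj₂ refl) = begin
  eq (+ d′) i               ≡⟨ cong (λ z → eq z i) (≡.trans step (cancel (+ d))) ⟩
  eq (+ d) i                ≡⟨ simplify (eq (+ d) i) (eq (+ d) (i - + 1)) ⟨
  + 1 * eq (+ d) i + (+ 1 - + 1) * eq (+ d) (i - + 1) ∎
  where
  cancel : ∀ x → x + + 1 - + 1 ≡ x
  cancel = solve-∀
  simplify : ∀ a b → + 1 * a + (+ 1 - + 1) * b ≡ a
  simplify = solve-∀

-- In this order, the totals over all insertions of `D E`, `D (1 − E)`, `(1 − D) E` and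
-- `(1 − D)(1 − E)`, where `D` and `E` indicate that des^B and ides^B are kept and the descent
-- numbers of `w` are expressed by `i` and `j`.
C₀₀ C₀₁ C₁₀ C₁₁ : ℤ → ℤ → ℤ → ℤ
C₀₀ n i j = n + i + j + + 2 * i * j
C₀₁ n i j = (+ 2 * n - + 1) * i - (+ 2 * i + + 1) * (j - + 1)
C₁₀ n i j = (+ 2 * n - + 1) * j - (+ 2 * j + + 1) * (i - + 1)
C₁₁ n i j = (+ 2 * n * n - n) + + 2 * (i - + 1) * (j - + 1) + (+ 1 - + 2 * n) * (i + j - + 2)

combine : ℤ → ℤ → ℤ → ℤ → ℤ → ℤ → List ℤ → ℤ
combine c₀₀ c₀₁ c₁₀ c₁₁ i j w =
  c₀₀ * statistic i j w + c₀₁ * statistic i (j - + 1) w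
    + c₁₀ * statistic (i - + 1) j w + c₁₁ * statistic (i - + 1) (j - + 1) w

module _ (w : List ℤ) (sp : SignedPerm (length w) w) (i j : ℤ) where

  open Insertion w sp

  private
    a a′ b b′ : ℤ
    a  = eq (+ desB w) i
    a′ = eq (+ desB w) (i - + 1)
    b  = eq (+ idesB w) j
    b′ = eq (+ idesB w) (j - + 1)

    outcome : ℤ → ℤ → ℤ
    outcome D E = (D * a + (+ 1 - D) * a′) * (E * b + (+ 1 - E) * b′)

    -- Groups the two signs so that only `D E`, `D`, `E` and a constant remain to be summed, which
    -- `∑-D*D` and `∑-D` provide.
    outcome-expand : ∀ a a′ b b′ D E D′ E′ →
      (D * a + (+ 1 - D) * a′) * (E * b + (+ 1 - E) * b′) + (D′ * a + (+ 1 - D′) * a′) * (E′ * b + (+ 1 - E′) * b′)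
        ≡ (a - a′) * (b - b′) * (D * E + D′ * E′) + ((a - a′) * b′ * (D + D′) + (a′ * (b - b′) * (E + E′) + + 2 * a′ * b′))
    outcome-expand = solve-∀

  statistic-ins : ∀ {p v} → p ≤ m → v ≤ m →
    statistic i j (ins p (+ suc v) w) + statistic i j (ins p -[1+ v ] w)
      ≡ outcome (D⁺ P p v) (D⁺ Q v p) + outcome (D⁻ P p v) (D⁻ Q v p)
  statistic-ins {p} {v} p≤m v≤m = cong₂ _+_
    (cong₂ _*_ (eq-step (desB w) (D⁺ P p v) i (desB-ins⁺ p≤m v≤m) (D⁺-0∨1 P p v))
               (eq-step (idesB w) (D⁺ Q v p) j (idesB-ins⁺ p≤m v≤m) (D⁺-0∨1 Q v p)))
    (cong₂ _*_ (eq-step (desB w) (D⁻ P p v) i (desB-ins⁻ p≤m v≤m) (D⁻-0∨1 P p v))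
               (eq-step (idesB w) (D⁻ Q v p) j (idesB-ins⁻ p≤m v≤m) (D⁻-0∨1 Q v p)))
    where
    D⁺-0∨1 : ∀ R p v → D⁺ R p v ≡ + 0 ⊎ D⁺ R p v ≡ + 1
    D⁺-0∨1 R p v = subst (λ d → d ≡ + 0 ⊎ d ≡ + 1) (keeps-D⁺ v R p) (keeps-0∨1 v _ (R p) (R (suc p)))
    D⁻-0∨1 : ∀ R p v → D⁻ R p v ≡ + 0 ⊎ D⁻ R p v ≡ + 1
    D⁻-0∨1 R p v = subst (λ d → d ≡ + 0 ⊎ d ≡ + 1) (keeps-D⁻ v R p) (keeps-0∨1 v _ (R p) (R (suc p)))

  ∑-statistic-ins :
    ∑[ p ← upTo n ] ∑[ v ← upTo n ] (statistic i j (ins p (+ suc v) w) + statistic i j (ins p -[1+ v ] w))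
      ≡ combine (C₀₀ (+ n) i j) (C₀₁ (+ n) i j) (C₁₀ (+ n) i j) (C₁₁ (+ n) i j) i j w
  ∑-statistic-ins = begin
    ∑[ p ← upTo n ] ∑[ v ← upTo n ] (statistic i j (ins p (+ suc v) w) + statistic i j (ins p -[1+ v ] w))
      ≡⟨ ∑-cong (upTo n) (λ {p} p∈ → ∑-cong (upTo n) (λ {v} v∈ → ≡.trans
           (statistic-ins (ℕ.s≤s⁻¹ (∈-upTo⁻ p∈)) (ℕ.s≤s⁻¹ (∈-upTo⁻ v∈)))
           (outcome-expand a a′ b b′ (D⁺ P p v) (D⁺ Q v p) (D⁻ P p v) (D⁻ Q v p)))) ⟩
    ∑[ p ← upTo n ] ∑[ v ← upTo n ] (α * x p v + (β * y p v + (γ * z p v + δ)))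
      ≡⟨ ≡.trans (+-split (λ p v → α * x p v) (λ p v → β * y p v + (γ * z p v + δ))) (cong₂ _+_ (*-pull α x)
           (≡.trans (+-split (λ p v → β * y p v) (λ p v → γ * z p v + δ)) (cong₂ _+_ (*-pull β y)
             (≡.trans (+-split (λ p v → γ * z p v) (λ _ _ → δ)) (cong₂ _+_ (*-pull γ z) ∑₂-const))))) ⟩
    α * (∑[ p ← upTo n ] ∑[ v ← upTo n ] x p v)
      + (β * (∑[ p ← upTo n ] ∑[ v ← upTo n ] y p v)
      + (γ * (∑[ p ← upTo n ] ∑[ v ← upTo n ] z p v) + + n * (+ n * δ)))
      ≡⟨ cong₂ _+_ (cong (α *_) ∑-D*D) (cong₂ _+_ (cong (β *_) (∑-D boundary-P))
           (cong (λ s → γ * s + + n * (+ n * δ)) (≡.trans (∑-swap (upTo n) (upTo n) z) (∑-D boundary-Q)))) ⟩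
    α * (+ n + descents n P + descents n Q + + 2 * descents n P * descents n Q)
      + (β * (+ 2 * + n * descents n P + + n) + (γ * (+ 2 * + n * descents n Q + + n) + + n * (+ n * δ)))
      ≡⟨ collect (+ n) (descents n P) (descents n Q) a a′ b b′ ⟩
    F (descents n P) (descents n Q)
      ≡⟨ cong₂ F descents-P descents-Q ⟩
    F (+ desB w) (+ idesB w)
      -- Each product of indicators allows `desB w` and `idesB w` to be replaced by the indices it
      -- tests for.
      ≡⟨ cong₂ _+_ (cong₂ _+_ (cong₂ _+_
           (substitute C₀₀′ i j)
           (substitute C₀₁′ i (j - + 1)))
           (substitute C₁₀′ (i - + 1) j))
           (substitute C₁₁′ (i - + 1) (j - + 1)) ⟩
    a * b * C₀₀′ i j + a * b′ * C₀₁′ i (j - + 1) + a′ * b * C₁₀′ (i - + 1) j + a′ * b′ * C₁₁′ (i - + 1) (j - + 1)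
      ≡⟨ normalise (+ n) i j (a * b) (a * b′) (a′ * b) (a′ * b′) ⟩
    combine (C₀₀ (+ n) i j) (C₀₁ (+ n) i j) (C₁₀ (+ n) i j) (C₁₁ (+ n) i j) i j w ∎
    where
    α β γ δ : ℤ
    α = (a - a′) * (b - b′)
    β = (a - a′) * b′
    γ = a′ * (b - b′)
    δ = + 2 * a′ * b′
    x y z : ℕ → ℕ → ℤ
    x p v = D⁺ P p v * D⁺ Q v p + D⁻ P p v * D⁻ Q v p
    y p v = D⁺ P p v + D⁻ P p v
    z p v = D⁺ Q v p + D⁻ Q v p
    +-split = ∑₂-+ (upTo n) (upTo n)
    *-pull  = ∑₂-*ˡ (upTo n) (upTo n)
    ∑-upTo-const : (c : ℤ) → ∑[ k ← upTo n ] c ≡ + n * c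
    ∑-upTo-const c = ≡.trans (∑-const (upTo n) c) (cong (λ k → + k * c) (length-upTo n))
    ∑₂-const : ∑[ p ← upTo n ] ∑[ v ← upTo n ] δ ≡ + n * (+ n * δ)
    ∑₂-const = ≡.trans (∑-ext (upTo n) (λ _ → ∑-upTo-const δ)) (∑-upTo-const _)
    C₀₀′ C₀₁′ C₁₀′ C₁₁′ : ℤ → ℤ → ℤ
    C₀₀′ = C₀₀ (+ n)
    -- The argument is `e + 1` because `b′` tests for `e = j − 1`; likewise `d + 1` goes with `a′`.
    C₀₁′ d e = C₀₁ (+ n) d (e + + 1)
    C₁₀′ d e = C₁₀ (+ n) (d + + 1) e
    C₁₁′ d e = C₁₁ (+ n) (d + + 1) (e + + 1)
    F : ℤ → ℤ → ℤ
    F d e = a * b * C₀₀′ d e + a * b′ * C₀₁′ d e + a′ * b * C₁₀′ d e + a′ * b′ * C₁₁′ d e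
    substitute : (f : ℤ → ℤ → ℤ) (i j : ℤ) →
      eq (+ desB w) i * eq (+ idesB w) j * f (+ desB w) (+ idesB w) ≡ eq (+ desB w) i * eq (+ idesB w) j * f i j
    substitute f i j = begin
      ⟦ d? ⟧ * ⟦ e? ⟧ * f (+ desB w) (+ idesB w) ≡⟨ ℤ.*-assoc ⟦ d? ⟧ ⟦ e? ⟧ _ ⟩
      ⟦ d? ⟧ * (⟦ e? ⟧ * f (+ desB w) (+ idesB w))
        ≡⟨ ⟦⟧-subst d? (λ d≡i → ⟦⟧-subst e? (λ e≡j → cong₂ f d≡i e≡j)) ⟩
      ⟦ d? ⟧ * (⟦ e? ⟧ * f i j)                  ≡⟨ ℤ.*-assoc ⟦ d? ⟧ ⟦ e? ⟧ _ ⟨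
      ⟦ d? ⟧ * ⟦ e? ⟧ * f i j ∎
      where
      d? = + desB w ≟ i
      e? = + idesB w ≟ j
    -- Here the four coefficients emerge, as polynomials in the descent numbers `d` and `e`.
    collect : ∀ n d e a a′ b b′ →
      (a - a′) * (b - b′) * (n + d + e + + 2 * d * e)
        + ((a - a′) * b′ * (+ 2 * n * d + n) + (a′ * (b - b′) * (+ 2 * n * e + n) + n * (n * (+ 2 * a′ * b′))))
      ≡ a * b * (n + d + e + + 2 * d * e)
        + a * b′ * ((+ 2 * n - + 1) * d - (+ 2 * d + + 1) * (e + + 1 - + 1))
        + a′ * b * ((+ 2 * n - + 1) * e - (+ 2 * e + + 1) * (d + + 1 - + 1))
        + a′ * b′ * ((+ 2 * n * n - n) + + 2 * (d + + 1 - + 1) * (e + + 1 - + 1) + (+ 1 - + 2 * n) * (d + + 1 + (e + + 1) - + 2))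
    collect = solve-∀
    normalise : ∀ n i j s t u v →
      s * (n + i + j + + 2 * i * j)
        + t * ((+ 2 * n - + 1) * i - (+ 2 * i + + 1) * (j - + 1 + + 1 - + 1))
        + u * ((+ 2 * n - + 1) * j - (+ 2 * j + + 1) * (i - + 1 + + 1 - + 1))
        + v * ((+ 2 * n * n - n) + + 2 * (i - + 1 + + 1 - + 1) * (j - + 1 + + 1 - + 1) + (+ 1 - + 2 * n) * (i - + 1 + + 1 + (j - + 1 + + 1) - + 2))
      ≡ (n + i + j + + 2 * i * j) * s
        + ((+ 2 * n - + 1) * i - (+ 2 * i + + 1) * (j - + 1)) * t
        + ((+ 2 * n - + 1) * j - (+ 2 * j + + 1) * (i - + 1)) * u
        + ((+ 2 * n * n - n) + + 2 * (i - + 1) * (j - + 1) + (+ 1 - + 2 * n) * (i + j - + 2)) * v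
    normalise = solve-∀

-- The coefficients in `combine` do not depend on `w`, so summing over `w` turns each statistic into
-- a value of `b̄`.
b̄-recurrence : ∀ m i j → let n = + suc m in
  n * b̄ (suc m) i j ≡ C₀₀ n i j * b̄ m i j + C₀₁ n i j * b̄ m i (j - + 1)
                    + C₁₀ n i j * b̄ m (i - + 1) j + C₁₁ n i j * b̄ m (i - + 1) (j - + 1)
b̄-recurrence m i j = begin
  + suc m * b̄ (suc m) i j
    ≡⟨ cong (+ suc m *_) (b̄-sum (suc m) i j) ⟩
  + suc m * ∑ (signedPerms (suc m)) (statistic i j)
    ≡⟨ ∑-signedPerms-suc m (statistic i j) ⟩
  ∑[ w ← signedPerms m ] ∑[ p ← upTo (suc m) ] ∑[ v ← upTo (suc m) ]
    (statistic i j (ins p (+ suc v) w) + statistic i j (ins p -[1+ v ] w))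
    ≡⟨ ∑-cong (signedPerms m) (λ w∈ → insertions (∈-signedPerms⁻ w∈)) ⟩
  ∑ (signedPerms m) (combine c₀₀ c₀₁ c₁₀ c₁₁ i j)
    ≡⟨ ≡.trans (∑-+ S _ _) (cong₂ _+_
         (≡.trans (∑-+ S _ _) (cong₂ _+_
           (≡.trans (∑-+ S _ _) (cong₂ _+_
             (scale c₀₀ i j)
             (scale c₀₁ i (j - + 1))))
           (scale c₁₀ (i - + 1) j)))
         (scale c₁₁ (i - + 1) (j - + 1))) ⟩
  c₀₀ * b̄ m i j + c₀₁ * b̄ m i (j - + 1) + c₁₀ * b̄ m (i - + 1) j + c₁₁ * b̄ m (i - + 1) (j - + 1) ∎
  where
  S = signedPerms m
  c₀₀ c₀₁ c₁₀ c₁₁ : ℤ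
  c₀₀ = C₀₀ (+ suc m) i j
  c₀₁ = C₀₁ (+ suc m) i j
  c₁₀ = C₁₀ (+ suc m) i j
  c₁₁ = C₁₁ (+ suc m) i j
  scale : ∀ c i j → ∑[ w ← S ] (c * statistic i j w) ≡ c * b̄ m i j
  scale c i j = ≡.trans (∑-*ˡ S c (statistic i j)) (cong (c *_) (sym (b̄-sum m i j)))
  insertions : ∀ {w} → SignedPerm m w →
    ∑[ p ← upTo (suc m) ] ∑[ v ← upTo (suc m) ] (statistic i j (ins p (+ suc v) w) + statistic i j (ins p -[1+ v ] w))
      ≡ combine c₀₀ c₀₁ c₁₀ c₁₁ i j w
  insertions {w} sp@(signedPerm refl _ _) = ∑-statistic-ins w sp i j

-- Truncated subtraction agrees with integer subtraction here because `2 (m + 1) ≥ 1`.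
pos-2n∸1 : ∀ m → + (2 ℕ.* suc m ℕ.∸ 1) ≡ + 2 * + suc m - + 1
pos-2n∸1 m = ≡.trans (cong (λ k → + (m ℕ.+ k)) (ℕ.+-identityʳ (suc m))) (double (+ m))
  where
  double : ∀ x → x + (+ 1 + x) ≡ + 2 * (+ 1 + x) - + 1
  double = solve-∀

theorem1p2 : (b̄ 1 (+ 0) (+ 0) ≡ + 1 × b̄ 1 (+ 1) (+ 1) ≡ + 1 × b̄ 1 (+ 0) (+ 1) ≡ + 0 × b̄ 1 (+ 1) (+ 0) ≡ + 0)
    × ((n i j : ℕ) → 2 ≤ n → i ≤ n → j ≤ n →
    (+ n) * b̄ n (+ i) (+ j)
    ≡ ((+ n) + (+ i) + (+ j) + (+ 2) * (+ i) * (+ j)) * b̄ (n Data.Nat.∸ 1) (+ i) (+ j)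
    + ((+ (2 Data.Nat.* n Data.Nat.∸ 1)) * (+ i) - ((+ 2) * (+ i) + (+ 1)) * ((+ j) - (+ 1))) * b̄ (n Data.Nat.∸ 1) (+ i) ((+ j) - (+ 1))
    + ((+ (2 Data.Nat.* n Data.Nat.∸ 1)) * (+ j) - ((+ 2) * (+ j) + (+ 1)) * ((+ i) - (+ 1))) * b̄ (n Data.Nat.∸ 1) ((+ i) - (+ 1)) (+ j)
    + (((+ 2) * (+ n) * (+ n) - (+ n)) + (+ 2) * ((+ i) - (+ 1)) * ((+ j) - (+ 1)) + ((+ 1) - (+ 2) * (+ n)) * ((+ i) + (+ j) - (+ 2))) * b̄ (n Data.Nat.∸ 1) ((+ i) - (+ 1)) ((+ j) - (+ 1)))
-- The initial values follow by evaluating `b̄` on the signed permutations of length 1.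
theorem1p2 = (refl , refl , refl , refl) , recurrence
  where
  recurrence : (n i j : ℕ) → 2 ≤ n → i ≤ n → j ≤ n → _
  recurrence (suc m) i j _ _ _ rewrite pos-2n∸1 m = b̄-recurrence m (+ i) (+ j)
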